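{- Let $a$ and $b$ be positive integers with $\gcd(a,b)=1$, let $\lambda\in\mathbb{C}$ with $\lambda\neq 0$, $\lambda^a\neq 1$ and $\lambda^b\neq 1$, and let $m$ be a nonnegative integer. Then \begin{align*} S_m^{(\lambda)}(a,b)&=\lambda^{a b-1}\sum_{\ell=0}^m\sum_{i=0}^{\ell+2}\binom{\ell+2}{i}\binom{m}{\ell}\frac{a^{m-\ell+i-1}b^{m-i+1}}{(\ell+1)(\ell+2)}\mathcal B_i(\lambda^a)\mathcal B_{\ell-i+2}(\lambda^b)\\ &\quad -\frac{1}{(m+1)(m+2)\lambda}\sum_{i=0}^{m+2}\binom{m+2}{i}a^{i-1}b^{m-i+1}\mathcal B_i(\lambda^a)\mathcal B_{m-i+2}(\lambda^b)\\ &\quad -\frac{\mathcal B_{m+1}(\lambda)}{(m+1)\lambda}. \end{align*}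
   Context: For coprime positive integers $a,b$, $\mathrm{NR}(a,b)$ denotes the (finite) set of all nonnegative integers $n$ that cannot be expressed in the form $n=ax+by$ with $x,y$ nonnegative integers. (Since $0$ is representable, all elements are positive.) For a nonnegative integer $m$ and $\lambda\neq 0$, $$S_m^{(\lambda)}(a,b):=\sum_{n\in \mathrm{NR}(a,b)}\lambda^{n-1}n^m.$$ For a complex number $\mu\neq 1$, the Apostol-Bernoulli numbers $\mathcal B_n(\mu)$ ($n\ge 0$) are defined by the power series expansion at $z=0$ $$\frac{z}{\mu e^z-1}=\sum_{n=0}^\infty \mathcal B_n(\mu)\frac{z^n}{n!}.$$ For example, $\mathcal B_0(\mu)=0$, $\mathcal B_1(\mu)=\frac{1}{\mu-1}$, $\mathcal B_2(\mu)=-\frac{2\mu}{(\mu-1)^2}$. Powers of $a$ and $b$ with exponent $-1$ mean the rational numbers $1/a$, $1/b$. -}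

module Defs where

open import Algebra.Apartness.Bundles using (HeytingCommutativeRing; HeytingField)
import Algebra.Apartness.Properties.HeytingCommutativeRing as HeytingProperties
open import Algebra.Bundles using (CommutativeRing)
open import Algebra.Structures using (IsCommutativeRing)
import Algebra.Definitions.RawMonoid as RawMonoidDefs
import Algebra.Properties.CommutativeMonoid.Sum as Sums
import Algebra.Properties.Ring as RingProperties
import Algebra.Properties.Semiring.Exp as Exponentiation
open import Data.Empty using (⊥-elim)
open import Data.Fin.Base using (Fin; zero; suc; toℕ)
open import Data.Integer.Base as ℤ using (ℤ; +_; -[1+_]; 1ℤ)
open import Data.List.Base using (List; filter; foldr; map; upTo)
open import Data.List.Membership.Propositional using (_∈_)
open import Data.List.Membership.Propositional.Properties using (∈-filter⁺; ∈-filter⁻; ∈-upTo⁺)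
open import Data.List.Relation.Unary.Unique.Propositional using (Unique)
import Data.List.Relation.Unary.Unique.Propositional.Properties as Unique
open import Data.Nat.Base as ℕ using (ℕ; NonZero; zero; suc; _∸_; _!)
import Data.Nat.Combinatorics as ℕ
import Data.Nat.Divisibility as ℕ
import Data.Nat.DivMod as ℕ
open import Data.Nat.GCD using (GCD; gcd; gcd-GCD; module Bézout)
import Data.Nat.Properties as ℕ
import Data.Nat.Tactic.RingSolver as ℕ-solver
open import Data.Product.Base using (Σ; ∃; ∃₂; _×_; _,_; proj₁; proj₂)
open import Data.Rational.Base as ℚ using (ℚ; 0ℚ; 1ℚ; ½; ∣_∣)
import Data.Rational.Properties as ℚ
import Data.Rational.Solver as ℚ-solver
open import Data.Sum.Base as Sum using (_⊎_; inj₁; inj₂)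
open import Data.Vec.Base using (Vec; []; _∷_; head; lookup)
open import Function.Base using (_∘_)
open import Function.Bundles using (_⇔_; mk⇔)
open import Level using (0ℓ; _⊔_)
open import Relation.Binary.PropositionalEquality
  using (_≡_; refl; sym; trans; cong; cong₂; subst; subst₂; module ≡-Reasoning)
import Relation.Binary.Reasoning.Setoid as SetoidReasoning
open import Relation.Nullary.Decidable using (Dec; yes; no; ¬?; map′; from-yes)
open import Relation.Nullary.Negation using (¬_)

-- ℝ is the Cauchy completion of ℚ in the style of Bishop: moduli of convergence
-- are data, equality is the setoid relation _≈_, and _#_ is the positive form of
-- x ≠ y (classically the two coincide).
module Real where

  open import Data.Rational.Base using (_+_; _*_; _-_; -_; _<_; _≤_)
  open ℚ-solver.+-*-Solver

  Eventually : (ℕ → Set) → Set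
  Eventually P = ∃ λ N → ∀ n → N ℕ.≤ n → P n

  IsCauchy : (ℕ → ℚ) → Set
  IsCauchy x = ∀ ε → 0ℚ < ε → ∃ λ N → ∀ m n → N ℕ.≤ m → N ℕ.≤ n → ∣ x m - x n ∣ < ε

  record ℝ : Set where
    no-eta-equality
    constructor mkℝ
    field
      seq    : ℕ → ℚ
      cauchy : IsCauchy seq

  open ℝ public

  infix 4 _≈_ _#_

  record _≈_ (x y : ℝ) : Set where
    constructor mk≈
    field
      close : ∀ ε → 0ℚ < ε → Eventually λ n → ∣ seq x n - seq y n ∣ < ε

  record _#_ (x y : ℝ) : Set where
    constructor mk#
    field
      gap   : ℚ
      0<gap : 0ℚ < gap
      apart : Eventually λ n → gap < ∣ seq x n - seq y n ∣

  open _≈_ public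
  open _#_ public

  private

    both : ∀ {P Q R : ℕ → Set} → (∀ n → P n → Q n → R n) →
           Eventually P → Eventually Q → Eventually R
    both f (M , p) (N , q) = M ℕ.⊔ N , λ n h →
      f n (p n (ℕ.≤-trans (ℕ.m≤m⊔n M N) h)) (q n (ℕ.≤-trans (ℕ.m≤n⊔m M N) h))

    each : ∀ {P Q : ℕ → Set} → (∀ n → P n → Q n) → Eventually P → Eventually Q
    each f (N , p) = N , λ n h → f n (p n h)

    pure : ∀ {P : ℕ → Set} → (∀ n → P n) → Eventually P
    pure f = 0 , λ n _ → f n

    now : ∀ {P : Set} → Eventually (λ _ → P) → P
    now (N , p) = p N ℕ.≤-refl

    half+half : ∀ ε → ½ * ε + ½ * ε ≡ ε
    half+half ε = trans (solve 2 (λ h e → h :* e :+ h :* e := (h :+ h) :* e) refl ½ ε) (ℚ.*-identityˡ ε)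

    0<* : ∀ {p q} → 0ℚ < p → 0ℚ < q → 0ℚ < p * q
    0<* {p} {q} 0<p 0<q = subst (_< p * q) (ℚ.*-zeroʳ p)
      (ℚ.*-monoʳ-<-pos p {{ℚ.positive 0<p}} 0<q)

    0<½* : ∀ {ε} → 0ℚ < ε → 0ℚ < ½ * ε
    0<½* {ε} = 0<* {½} {ε} (ℚ.positive⁻¹ ½)

    quotient : ∀ B ε → 0ℚ < B → 0ℚ < ε → ∃ λ δ → 0ℚ < δ × B * δ ≡ ε
    quotient B ε 0<B 0<ε =
      ℚ.1/ B * ε , 0<* {ℚ.1/ B} {ε} (ℚ.positive⁻¹ _ {{ℚ.1/pos⇒pos B}}) 0<ε ,
      trans (sym (ℚ.*-assoc B (ℚ.1/ B) ε)) (trans (cong (_* ε) (ℚ.*-inverseʳ B)) (ℚ.*-identityˡ ε))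
      where instance
        _ = ℚ.positive 0<B
        _ = ℚ.pos⇒nonZero B

    triangle : ∀ p q r → ∣ p - r ∣ ≤ ∣ p - q ∣ + ∣ q - r ∣
    triangle p q r = subst (_≤ ∣ p - q ∣ + ∣ q - r ∣)
      (cong ∣_∣ (solve 3 (λ p q r → (p :- q) :+ (q :- r) := p :- r) refl p q r))
      (ℚ.∣p+q∣≤∣p∣+∣q∣ (p - q) (q - r))

    ∣-∣-comm : ∀ p q → ∣ p - q ∣ ≡ ∣ q - p ∣
    ∣-∣-comm p q = trans (cong ∣_∣ (solve 2 (λ p q → p :- q := :- (q :- p)) refl p q)) (ℚ.∣-p∣≡∣p∣ (q - p))

    ∣p∣≤∣p-q∣+∣q∣ : ∀ p q → ∣ p ∣ ≤ ∣ p - q ∣ + ∣ q ∣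
    ∣p∣≤∣p-q∣+∣q∣ p q = subst (_≤ ∣ p - q ∣ + ∣ q ∣)
      (cong ∣_∣ (solve 2 (λ p q → (p :- q) :+ q := p) refl p q)) (ℚ.∣p+q∣≤∣p∣+∣q∣ (p - q) q)

    ∣p*q∣< : ∀ {p q B C} → ∣ p ∣ < B → ∣ q ∣ < C → ∣ p * q ∣ < B * C
    ∣p*q∣< {p} {q} {B} {C} p<B q<C = subst (_< B * C) (sym (ℚ.∣p*q∣≡∣p∣*∣q∣ p q))
      (ℚ.≤-<-trans
        (ℚ.*-monoʳ-≤-nonNeg ∣ q ∣ {{ℚ.nonNegative (ℚ.0≤∣p∣ q)}} (ℚ.<⇒≤ p<B))
        (ℚ.*-monoʳ-<-pos B {{ℚ.positive (ℚ.≤-<-trans (ℚ.0≤∣p∣ p) p<B)}} q<C))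

    *-close : ∀ {p q p′ q′ B C δ₁ δ₂} → ∣ p ∣ < B → ∣ q′ ∣ < C → ∣ p - p′ ∣ < δ₁ → ∣ q - q′ ∣ < δ₂ →
              ∣ p * q - p′ * q′ ∣ < C * δ₁ + B * δ₂
    *-close {p} {q} {p′} {q′} {B} {C} {δ₁} {δ₂} p<B q′<C hp hq = subst (_< C * δ₁ + B * δ₂)
      (cong ∣_∣ (solve 4 (λ p q p′ q′ → q′ :* (p :- p′) :+ p :* (q :- q′) := p :* q :- p′ :* q′) refl p q p′ q′))
      (ℚ.≤-<-trans (ℚ.∣p+q∣≤∣p∣+∣q∣ (q′ * (p - p′)) (p * (q - q′)))
        (ℚ.+-mono-< (∣p*q∣< q′<C hp) (∣p*q∣< p<B hq)))

    +-close : ∀ {ε} p q p′ q′ → ∣ p - p′ ∣ < ½ * ε → ∣ q - q′ ∣ < ½ * ε → ∣ (p + q) - (p′ + q′) ∣ < ε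
    +-close {ε} p q p′ q′ hp hq = subst₂ _<_
      (cong ∣_∣ (solve 4 (λ p q p′ q′ → (p :- p′) :+ (q :- q′) := (p :+ q) :- (p′ :+ q′)) refl p q p′ q′))
      (half+half ε)
      (ℚ.≤-<-trans (ℚ.∣p+q∣≤∣p∣+∣q∣ (p - p′) (q - q′)) (ℚ.+-mono-< hp hq))

    -‿close : ∀ p p′ → ∣ - p - - p′ ∣ ≡ ∣ p - p′ ∣
    -‿close p p′ = trans
      (cong ∣_∣ (solve 2 (λ p p′ → (:- p) :- (:- p′) := :- (p :- p′)) refl p p′)) (ℚ.∣-p∣≡∣p∣ (p - p′))

    C*δ₁+B*δ₂≡ε : ∀ {ε B C δ₁ δ₂} → C * δ₁ ≡ ½ * ε → B * δ₂ ≡ ½ * ε → C * δ₁ + B * δ₂ ≡ ε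
    C*δ₁+B*δ₂≡ε {ε} e₁ e₂ = trans (cong₂ _+_ e₁ e₂) (half+half ε)

    bounded : ∀ x → IsCauchy x → ∃ λ B → 0ℚ < B × Eventually λ n → ∣ x n ∣ < B
    bounded x c = let N , h = c 1ℚ (ℚ.positive⁻¹ 1ℚ) in
      1ℚ + ∣ x N ∣ ,
      ℚ.<-≤-trans (ℚ.positive⁻¹ 1ℚ) (subst (_≤ 1ℚ + ∣ x N ∣) (ℚ.+-identityʳ 1ℚ) (ℚ.+-monoʳ-≤ 1ℚ (ℚ.0≤∣p∣ (x N)))) ,
      N , λ n N≤n → ℚ.≤-<-trans (∣p∣≤∣p-q∣+∣q∣ (x n) (x N)) (ℚ.+-monoˡ-< ∣ x N ∣ (h n N N≤n ℕ.≤-refl))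

  -- Opaque because conversion checking would otherwise unfold the moduli.
  abstract

    +-cauchy : ∀ {x y} → IsCauchy x → IsCauchy y → IsCauchy (λ n → x n + y n)
    +-cauchy {x} {y} cx cy ε 0<ε =
      let M , p = cx (½ * ε) (0<½* {ε} 0<ε)
          N , q = cy (½ * ε) (0<½* {ε} 0<ε)
      in M ℕ.⊔ N , λ m n hm hn → +-close (x m) (y m) (x n) (y n)
        (p m n (ℕ.m⊔n≤o⇒m≤o M N hm) (ℕ.m⊔n≤o⇒m≤o M N hn))
        (q m n (ℕ.m⊔n≤o⇒n≤o M N hm) (ℕ.m⊔n≤o⇒n≤o M N hn))

    -‿cauchy : ∀ {x} → IsCauchy x → IsCauchy (λ n → - x n)
    -‿cauchy {x} cx ε 0<ε = let N , p = cx ε 0<ε in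
      N , λ m n hm hn → subst (_< ε) (sym (-‿close (x m) (x n))) (p m n hm hn)

    *-cauchy : ∀ {x y} → IsCauchy x → IsCauchy y → IsCauchy (λ n → x n * y n)
    *-cauchy {x} {y} cx cy ε 0<ε =
      let B , 0<B , K , hB = bounded x cx
          C , 0<C , L , hC = bounded y cy
          δ₁ , 0<δ₁ , e₁ = quotient C (½ * ε) 0<C (0<½* {ε} 0<ε)
          δ₂ , 0<δ₂ , e₂ = quotient B (½ * ε) 0<B (0<½* {ε} 0<ε)
          M , p = cx δ₁ 0<δ₁
          N , q = cy δ₂ 0<δ₂
      in (K ℕ.⊔ L) ℕ.⊔ (M ℕ.⊔ N) , λ m n hm hn →
        subst (∣ x m * y m - x n * y n ∣ <_) (C*δ₁+B*δ₂≡ε {ε} {B} {C} {δ₁} {δ₂} e₁ e₂)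
          (*-close {x m} {y m} {x n} {y n} {B} {C} {δ₁} {δ₂}
            (hB m (ℕ.m⊔n≤o⇒m≤o K L (ℕ.m⊔n≤o⇒m≤o _ (M ℕ.⊔ N) hm)))
            (hC n (ℕ.m⊔n≤o⇒n≤o K L (ℕ.m⊔n≤o⇒m≤o _ (M ℕ.⊔ N) hn)))
            (p m n (ℕ.m⊔n≤o⇒m≤o M N (ℕ.m⊔n≤o⇒n≤o (K ℕ.⊔ L) _ hm)) (ℕ.m⊔n≤o⇒m≤o M N (ℕ.m⊔n≤o⇒n≤o (K ℕ.⊔ L) _ hn)))
            (q m n (ℕ.m⊔n≤o⇒n≤o M N (ℕ.m⊔n≤o⇒n≤o (K ℕ.⊔ L) _ hm)) (ℕ.m⊔n≤o⇒n≤o M N (ℕ.m⊔n≤o⇒n≤o (K ℕ.⊔ L) _ hn))))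

  infixl 6 _+ᴿ_
  infixl 7 _*ᴿ_
  infix  8 -ᴿ_

  _+ᴿ_ _*ᴿ_ : ℝ → ℝ → ℝ
  x +ᴿ y = mkℝ (λ n → seq x n + seq y n) (+-cauchy {seq x} {seq y} (cauchy x) (cauchy y))
  x *ᴿ y = mkℝ (λ n → seq x n * seq y n) (*-cauchy {seq x} {seq y} (cauchy x) (cauchy y))

  -ᴿ_ : ℝ → ℝ
  -ᴿ x = mkℝ (λ n → - seq x n) (-‿cauchy {seq x} (cauchy x))

  fromℚ : ℚ → ℝ
  fromℚ q = mkℝ (λ _ → q) λ ε 0<ε → 0 , λ _ _ _ _ → subst (_< ε) (cong ∣_∣ (sym (ℚ.+-inverseʳ q))) 0<ε

  0ᴿ 1ᴿ : ℝ
  0ᴿ = fromℚ 0ℚ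
  1ᴿ = fromℚ 1ℚ

  private

    eventually≡⇒≈ : ∀ {x y} → (Eventually λ n → seq x n ≡ seq y n) → x ≈ y
    eventually≡⇒≈ {x} {y} e = mk≈ λ ε 0<ε →
      each (λ n e → subst (λ q → ∣ seq x n - q ∣ < ε) e
        (subst (_< ε) (cong ∣_∣ (sym (ℚ.+-inverseʳ (seq x n)))) 0<ε)) e

  pointwise⇒≈ : ∀ {x y} → (∀ n → seq x n ≡ seq y n) → x ≈ y
  pointwise⇒≈ e = eventually≡⇒≈ (pure e)

  private

    ≈-sym : ∀ {x y} → x ≈ y → y ≈ x
    ≈-sym {x} {y} x≈y = mk≈ λ ε 0<ε →
      each (λ n → subst (_< ε) (∣-∣-comm (seq x n) (seq y n))) (close x≈y ε 0<ε)

    ≈-trans : ∀ {x y z} → x ≈ y → y ≈ z → x ≈ z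
    ≈-trans {x} {y} {z} x≈y y≈z = mk≈ λ ε 0<ε →
      both (λ n p q → subst (∣ seq x n - seq z n ∣ <_) (half+half ε)
             (ℚ.≤-<-trans (triangle (seq x n) (seq y n) (seq z n)) (ℚ.+-mono-< p q)))
        (close x≈y (½ * ε) (0<½* {ε} 0<ε)) (close y≈z (½ * ε) (0<½* {ε} 0<ε))

    +-cong : ∀ {x x′ y y′} → x ≈ x′ → y ≈ y′ → x +ᴿ y ≈ x′ +ᴿ y′
    +-cong {x} {x′} {y} {y′} p q = mk≈ λ ε 0<ε →
      both (λ n → +-close (seq x n) (seq y n) (seq x′ n) (seq y′ n))
        (close p (½ * ε) (0<½* {ε} 0<ε)) (close q (½ * ε) (0<½* {ε} 0<ε))

    *-cong : ∀ {x x′ y y′} → x ≈ x′ → y ≈ y′ → x *ᴿ y ≈ x′ *ᴿ y′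
    *-cong {x} {x′} {y} {y′} p q = mk≈ λ ε 0<ε →
      let B , 0<B , hB = bounded (seq x) (cauchy x)
          C , 0<C , hC = bounded (seq y′) (cauchy y′)
          δ₁ , 0<δ₁ , e₁ = quotient C (½ * ε) 0<C (0<½* {ε} 0<ε)
          δ₂ , 0<δ₂ , e₂ = quotient B (½ * ε) 0<B (0<½* {ε} 0<ε)
      in both (λ n (b , c) (h₁ , h₂) →
             subst (∣ seq x n * seq y n - seq x′ n * seq y′ n ∣ <_) (C*δ₁+B*δ₂≡ε {ε} {B} {C} {δ₁} {δ₂} e₁ e₂)
               (*-close {seq x n} {seq y n} {seq x′ n} {seq y′ n} {B} {C} {δ₁} {δ₂} b c h₁ h₂))
        (both (λ _ → _,_) hB hC) (both (λ _ → _,_) (close p δ₁ 0<δ₁) (close q δ₂ 0<δ₂))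

    -‿cong : ∀ {x y} → x ≈ y → -ᴿ x ≈ -ᴿ y
    -‿cong {x} {y} p = mk≈ λ ε 0<ε →
      each (λ n → subst (_< ε) (sym (-‿close (seq x n) (seq y n)))) (close p ε 0<ε)

  isCommutativeRing : IsCommutativeRing _≈_ _+ᴿ_ _*ᴿ_ -ᴿ_ 0ᴿ 1ᴿ
  isCommutativeRing = record
    { isRing = record
      { +-isAbelianGroup = record
        { isGroup = record
          { isMonoid = record
            { isSemigroup = record
              { isMagma = record
                { isEquivalence = record
                  { refl  = pointwise⇒≈ (λ _ → refl)
                  ; sym   = ≈-sym
                  ; trans = ≈-trans
                  }
                ; ∙-cong = +-cong
                }
              ; assoc = λ x y z → pointwise⇒≈ (λ n → ℚ.+-assoc (seq x n) (seq y n) (seq z n))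
              }
            ; identity = (λ x → pointwise⇒≈ (λ n → ℚ.+-identityˡ (seq x n)))
                       , (λ x → pointwise⇒≈ (λ n → ℚ.+-identityʳ (seq x n)))
            }
          ; inverse = (λ x → pointwise⇒≈ (λ n → ℚ.+-inverseˡ (seq x n)))
                    , (λ x → pointwise⇒≈ (λ n → ℚ.+-inverseʳ (seq x n)))
          ; ⁻¹-cong = -‿cong
          }
        ; comm = λ x y → pointwise⇒≈ (λ n → ℚ.+-comm (seq x n) (seq y n))
        }
      ; *-cong = *-cong
      ; *-assoc = λ x y z → pointwise⇒≈ (λ n → ℚ.*-assoc (seq x n) (seq y n) (seq z n))
      ; *-identity = (λ x → pointwise⇒≈ (λ n → ℚ.*-identityˡ (seq x n)))
                   , (λ x → pointwise⇒≈ (λ n → ℚ.*-identityʳ (seq x n)))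
      ; distrib = (λ x y z → pointwise⇒≈ (λ n → ℚ.*-distribˡ-+ (seq x n) (seq y n) (seq z n)))
                , (λ x y z → pointwise⇒≈ (λ n → ℚ.*-distribʳ-+ (seq x n) (seq y n) (seq z n)))
      }
    ; *-comm = λ x y → pointwise⇒≈ (λ n → ℚ.*-comm (seq x n) (seq y n))
    }

  private

    small-or-apart : ∀ u → IsCauchy u → ∀ ε → 0ℚ < ε →
      (Eventually λ n → ∣ u n ∣ < ε) ⊎ (∃ λ δ → 0ℚ < δ × Eventually λ n → δ < ∣ u n ∣)
    small-or-apart u cu ε 0<ε = decide (∣ u N ∣ ℚ.<? ½ * ε)
      where
      ¼ε = ½ * (½ * ε)

      0<¼ε : 0ℚ < ¼ε
      0<¼ε = 0<½* {½ * ε} (0<½* {ε} 0<ε)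

      N = proj₁ (cu ¼ε 0<¼ε)

      h : ∀ m n → N ℕ.≤ m → N ℕ.≤ n → ∣ u m - u n ∣ < ¼ε
      h = proj₂ (cu ¼ε 0<¼ε)

      ¼ε<½ε : ¼ε < ½ * ε
      ¼ε<½ε = subst₂ _<_ (ℚ.+-identityˡ ¼ε) (half+half (½ * ε)) (ℚ.+-monoˡ-< ¼ε 0<¼ε)

      decide : Dec (∣ u N ∣ < ½ * ε) →
        (Eventually λ n → ∣ u n ∣ < ε) ⊎ (∃ λ δ → 0ℚ < δ × Eventually λ n → δ < ∣ u n ∣)
      decide (yes uN<½ε) = inj₁ (N , λ n N≤n → ℚ.≤-<-trans (∣p∣≤∣p-q∣+∣q∣ (u n) (u N))
        (subst (∣ u n - u N ∣ + ∣ u N ∣ <_) (half+half ε)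
          (ℚ.+-mono-< (ℚ.<-trans (h n N N≤n ℕ.≤-refl) ¼ε<½ε) uN<½ε)))
      decide (no uN≮½ε) = inj₂ (¼ε , 0<¼ε , N , λ n N≤n →
        ℚ.≰⇒> λ un≤ → uN≮½ε (ℚ.≤-<-trans (∣p∣≤∣p-q∣+∣q∣ (u N) (u n))
          (subst (∣ u N - u n ∣ + ∣ u n ∣ <_) (half+half (½ * ε))
            (ℚ.+-mono-<-≤ (h N n ℕ.≤-refl N≤n) un≤))))

    #-sym : ∀ {x y} → x # y → y # x
    #-sym {x} {y} (mk# δ 0<δ h) = mk# δ 0<δ (each (λ n → subst (δ <_) (∣-∣-comm (seq x n) (seq y n))) h)

    #-cotrans : ∀ {x y} → x # y → ∀ z → x # z ⊎ z # y
    #-cotrans {x} {y} (mk# δ 0<δ h) z =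
      decide (small-or-apart _ (cauchy (x +ᴿ -ᴿ z)) (½ * δ) (0<½* {δ} 0<δ))
      where
      decide : (Eventually λ n → ∣ seq x n - seq z n ∣ < ½ * δ) ⊎
               (∃ λ η → 0ℚ < η × Eventually λ n → η < ∣ seq x n - seq z n ∣) → x # z ⊎ z # y
      decide (inj₂ (η , 0<η , a)) = inj₁ (mk# η 0<η a)
      decide (inj₁ small) = inj₂ (mk# (½ * δ) (0<½* {δ} 0<δ)
        (both (λ n p q → ℚ.≰⇒> λ r → ℚ.<-irrefl refl (ℚ.<-trans p
          (ℚ.≤-<-trans (triangle (seq x n) (seq z n) (seq y n))
            (subst (∣ seq x n - seq z n ∣ + ∣ seq z n - seq y n ∣ <_) (half+half δ)
              (ℚ.+-mono-<-≤ q r))))) h small))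

    ¬#⇒≈ : ∀ {x y} → ¬ x # y → x ≈ y
    ¬#⇒≈ {x} {y} ¬x#y = mk≈ λ ε 0<ε → decide (small-or-apart _ (cauchy (x +ᴿ -ᴿ y)) ε 0<ε)
      where
      decide : ∀ {ε} → (Eventually λ n → ∣ seq x n - seq y n ∣ < ε) ⊎
               (∃ λ η → 0ℚ < η × Eventually λ n → η < ∣ seq x n - seq y n ∣) →
               Eventually λ n → ∣ seq x n - seq y n ∣ < ε
      decide (inj₁ small)         = small
      decide (inj₂ (η , 0<η , a)) = ⊥-elim (¬x#y (mk# η 0<η a))

    ≈⇒¬# : ∀ {x y} → x ≈ y → ¬ x # y
    ≈⇒¬# x≈y (mk# δ 0<δ h) = now (both (λ _ p q → ℚ.<-asym p q) h (close x≈y δ 0<δ))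

    invℚ : ℚ → ℚ
    invℚ q with q ℚ.≟ 0ℚ
    ... | yes _  = 0ℚ
    ... | no q≢0 = ℚ.1/_ q {{ℚ.≢-nonZero q≢0}}

    *-invℚ : ∀ {q δ} → 0ℚ < δ → δ < ∣ q ∣ → q * invℚ q ≡ 1ℚ
    *-invℚ {q} 0<δ δ<q with q ℚ.≟ 0ℚ
    ... | yes refl = ⊥-elim (ℚ.<-asym 0<δ δ<q)
    ... | no q≢0   = ℚ.*-inverseʳ q {{ℚ.≢-nonZero q≢0}}

    ∣invℚ∣< : ∀ {q δ κ} → 0ℚ < δ → δ * κ ≡ 1ℚ → δ < ∣ q ∣ → ∣ invℚ q ∣ < κ
    ∣invℚ∣< {q} {δ} {κ} 0<δ δκ≡1 δ<q = ℚ.≰⇒> λ κ≤ → ℚ.<-irrefl refl (ℚ.<-≤-trans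
      (subst (_< ∣ q ∣ * κ) δκ≡1 (ℚ.*-monoˡ-<-pos κ {{0<κ}} δ<q))
      (subst (∣ q ∣ * κ ≤_) (trans (sym (ℚ.∣p*q∣≡∣p∣*∣q∣ q (invℚ q))) (cong ∣_∣ (*-invℚ 0<δ δ<q)))
        (ℚ.*-monoˡ-≤-nonNeg ∣ q ∣ {{ℚ.nonNegative (ℚ.0≤∣p∣ q)}} κ≤)))
      where
      0<κ : ℚ.Positive κ
      0<κ = ℚ.positive (ℚ.*-cancelˡ-<-nonNeg δ {{ℚ.nonNegative (ℚ.<⇒≤ 0<δ)}}
        (subst₂ _<_ (sym (ℚ.*-zeroʳ δ)) (sym δκ≡1) (ℚ.positive⁻¹ 1ℚ)))

    inv-cauchy : ∀ {u} → IsCauchy u → ∀ {δ} → 0ℚ < δ → (Eventually λ n → δ < ∣ u n ∣) →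
                 IsCauchy (λ n → invℚ (u n))
    inv-cauchy {u} cu {δ} 0<δ (M , h) ε 0<ε
      = let κ , 0<κ , δκ≡1 = quotient δ 1ℚ 0<δ (ℚ.positive⁻¹ 1ℚ)
            η , 0<η , κη≡ε = quotient κ ε 0<κ 0<ε
            ζ , 0<ζ , κζ≡η = quotient κ η 0<κ 0<η
            N , p = cu ζ 0<ζ
        in M ℕ.⊔ N , λ m n hm hn →
        let δ<m = h m (ℕ.m⊔n≤o⇒m≤o M N hm)
            δ<n = h n (ℕ.m⊔n≤o⇒m≤o M N hn)
            i   = invℚ (u m)
            j   = invℚ (u n)
        in subst₂ _<_
             (cong ∣_∣ (begin
               i * (j * (u n - u m))           ≡⟨ solve 4 (λ i j x y → i :* (j :* (y :- x)) := (y :* j) :* i :- (x :* i) :* j) refl i j (u m) (u n) ⟩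
               (u n * j) * i - (u m * i) * j   ≡⟨ cong₂ (λ p q → p * i - q * j) (*-invℚ 0<δ δ<n) (*-invℚ 0<δ δ<m) ⟩
               1ℚ * i - 1ℚ * j                 ≡⟨ cong₂ _-_ (ℚ.*-identityˡ i) (ℚ.*-identityˡ j) ⟩
               i - j                           ∎))
             (trans (cong (κ *_) κζ≡η) κη≡ε)
             (∣p*q∣< (∣invℚ∣< 0<δ δκ≡1 δ<m) (∣p*q∣< (∣invℚ∣< 0<δ δκ≡1 δ<n)
               (p n m (ℕ.m⊔n≤o⇒n≤o M N hn) (ℕ.m⊔n≤o⇒n≤o M N hm))))
      where open ≡-Reasoning

  commutativeRing : CommutativeRing 0ℓ 0ℓ
  commutativeRing = record { isCommutativeRing = isCommutativeRing }

  inverse : ∀ {x y} → x # y → ∃ λ w → (x +ᴿ -ᴿ y) *ᴿ w ≈ 1ᴿ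
  inverse {x} {y} (mk# δ 0<δ h) = w , eventually≡⇒≈ (each (λ n → *-invℚ 0<δ) h)
    where
    w : ℝ
    w = mkℝ (λ n → invℚ (seq (x +ᴿ -ᴿ y) n)) (inv-cauchy (cauchy (x +ᴿ -ᴿ y)) 0<δ h)

  invertible⇒# : ∀ {x y w} → (x +ᴿ -ᴿ y) *ᴿ w ≈ 1ᴿ → x # y
  invertible⇒# {x} {y} {w} e =
    let B , 0<B , hB = bounded (seq w) (cauchy w)
        δ , 0<δ , Bδ≡½ = quotient B ½ 0<B (ℚ.positive⁻¹ ½)
    in mk# δ 0<δ (both (λ n b p → ℚ.≰⇒> λ u≤δ → contra (seq (x +ᴿ -ᴿ y) n) (seq w n) 0<δ Bδ≡½ b p u≤δ)
      hB (close e ½ (ℚ.positive⁻¹ ½)))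
    where
    contra : ∀ u v {B δ} → 0ℚ < δ → B * δ ≡ ½ → ∣ v ∣ < B → ∣ u * v - 1ℚ ∣ < ½ → ¬ ∣ u ∣ ≤ δ
    contra u v {B} {δ} 0<δ Bδ≡½ v<B uv≈1 u≤δ = ℚ.<-irrefl {1ℚ} refl
      (ℚ.≤-<-trans (∣p∣≤∣p-q∣+∣q∣ 1ℚ (u * v))
        (ℚ.+-mono-< (subst (_< ½) (∣-∣-comm (u * v) 1ℚ) uv≈1) uv<½))
      where
      uv<½ : ∣ u * v ∣ < ½
      uv<½ = subst₂ _<_ (sym (ℚ.∣p*q∣≡∣p∣*∣q∣ u v)) (trans (ℚ.*-comm δ B) Bδ≡½)
        (ℚ.≤-<-trans (ℚ.*-monoʳ-≤-nonNeg ∣ v ∣ {{ℚ.nonNegative (ℚ.0≤∣p∣ v)}} u≤δ)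
          (ℚ.*-monoʳ-<-pos δ {{ℚ.positive 0<δ}} v<B))

  heytingField : HeytingField 0ℓ 0ℓ 0ℓ
  heytingField = record
    { _≈_ = _≈_ ; _#_ = _#_ ; _+_ = _+ᴿ_ ; _*_ = _*ᴿ_ ; -_ = -ᴿ_ ; 0# = 0ᴿ ; 1# = 1ᴿ
    ; isHeytingField = record
      { isHeytingCommutativeRing = record
        { isCommutativeRing   = isCommutativeRing
        ; isApartnessRelation = record
          { irrefl  = ≈⇒¬#
          ; sym     = #-sym
          ; cotrans = #-cotrans
          }
        ; #⇒invertible = λ {x} {y} x#y → let w , e = inverse x#y in
            w , ≈-trans (*-comm w (x +ᴿ -ᴿ y)) e , e
        ; invertible⇒# = λ {x} {y} (w , _ , e) → invertible⇒# {x} {y} {w} e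
        }
      ; tight = λ _ _ → ¬#⇒≈ , ≈⇒¬#
      }
    }
    where open CommutativeRing commutativeRing using (*-comm)

  x#y⇒x-y#0 : ∀ {x y} → x # y → x +ᴿ -ᴿ y # 0ᴿ
  x#y⇒x-y#0 (mk# δ 0<δ h) = mk# δ 0<δ (each (λ n → subst (λ p → δ < ∣ p ∣) (sym (ℚ.+-identityʳ _))) h)

  x#0⇒x²+y²#0 : ∀ {x} y → x # 0ᴿ → x *ᴿ x +ᴿ y *ᴿ y # 0ᴿ
  x#0⇒x²+y²#0 {x} y (mk# δ 0<δ h) = mk# (δ * δ) (0<* {δ} {δ} 0<δ 0<δ) (each (λ n → bound (seq x n) (seq y n)) h)
    where
    0≤sq : ∀ p → 0ℚ ≤ p * p
    0≤sq p with ℚ.∣p∣≡p∨∣p∣≡-p p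
    ... | inj₁ e = subst (0ℚ ≤_) (trans (ℚ.∣p*q∣≡∣p∣*∣q∣ p p) (cong₂ _*_ e e)) (ℚ.0≤∣p∣ (p * p))
    ... | inj₂ e = subst (0ℚ ≤_) (trans (ℚ.∣p*q∣≡∣p∣*∣q∣ p p)
        (trans (cong₂ _*_ e e) (solve 1 (λ p → (:- p) :* (:- p) := p :* p) refl p))) (ℚ.0≤∣p∣ (p * p))

    bound : ∀ p q → δ < ∣ p - 0ℚ ∣ → δ * δ < ∣ (p * p + q * q) - 0ℚ ∣
    bound p q δ<p = subst (δ * δ <_)
      (trans (sym (ℚ.0≤p⇒∣p∣≡p (ℚ.+-mono-≤ {0ℚ} {p * p} {0ℚ} (0≤sq p) (0≤sq q)))) (cong ∣_∣ (sym (ℚ.+-identityʳ _))))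
      (ℚ.<-≤-trans δ²<p² (subst (_≤ p * p + q * q) (ℚ.+-identityʳ (p * p)) (ℚ.+-monoʳ-≤ (p * p) (0≤sq q))))
      where
      δ<∣p∣ : δ < ∣ p ∣
      δ<∣p∣ = subst (λ r → δ < ∣ r ∣) (ℚ.+-identityʳ p) δ<p

      δ²<p² : δ * δ < p * p
      δ²<p² = subst (δ * δ <_) (trans (sym (ℚ.∣p*q∣≡∣p∣*∣q∣ p p)) (ℚ.0≤p⇒∣p∣≡p (0≤sq p)))
        (ℚ.<-trans (ℚ.*-monoʳ-<-pos δ {{ℚ.positive 0<δ}} δ<∣p∣)
          (ℚ.*-monoˡ-<-pos ∣ p ∣ {{ℚ.positive (ℚ.<-trans 0<δ δ<∣p∣)}} δ<∣p∣))

  open RawMonoidDefs (CommutativeRing.+-rawMonoid commutativeRing) using () renaming (_×_ to _·_)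

  private

    0≤n·1 : ∀ n k → 0ℚ ≤ seq (n · 1ᴿ) k
    0≤n·1 zero    k = ℚ.≤-refl
    0≤n·1 (suc n) k = ℚ.+-mono-≤ {0ℚ} {1ℚ} {0ℚ} {seq (n · 1ᴿ) k} (ℚ.<⇒≤ (ℚ.positive⁻¹ 1ℚ)) (0≤n·1 n k)

    ½<1+p : ∀ p → 0ℚ ≤ p → ½ < ∣ (1ℚ + p) - 0ℚ ∣
    ½<1+p p 0≤p = subst (½ <_)
      (trans (sym (ℚ.0≤p⇒∣p∣≡p (ℚ.≤-trans (ℚ.<⇒≤ (ℚ.positive⁻¹ 1ℚ)) 1≤1+p))) (cong ∣_∣ (sym (ℚ.+-identityʳ (1ℚ + p)))))
      (ℚ.<-≤-trans (from-yes (½ ℚ.<? 1ℚ)) 1≤1+p)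
      where
      1≤1+p : 1ℚ ≤ 1ℚ + p
      1≤1+p = subst (_≤ 1ℚ + p) (ℚ.+-identityʳ 1ℚ) (ℚ.+-monoʳ-≤ 1ℚ {0ℚ} {p} 0≤p)

  n·1#0 : ∀ n .{{_ : NonZero n}} → n · 1ᴿ # 0ᴿ
  n·1#0 (suc n) = mk# ½ (ℚ.positive⁻¹ ½) (pure λ k → ½<1+p (seq (n · 1ᴿ) k) (0≤n·1 n k))

module Complex where

  open Real using (ℝ; seq; pointwise⇒≈; _+ᴿ_; _*ᴿ_; -ᴿ_; 0ᴿ; 1ᴿ; n·1#0)
  open ℚ-solver.+-*-Solver

  private
    module R = HeytingField Real.heytingField

  infix 5 _+i_

  record ℂ : Set where
    constructor _+i_
    field
      re im : ℝ

  open ℂ public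

  infix 4 _≈_ _#_

  _≈_ _#_ : ℂ → ℂ → Set
  z ≈ w = re z R.≈ re w × im z R.≈ im w
  z # w = re z R.# re w ⊎ im z R.# im w

  infixl 6 _+ᶜ_
  infixl 7 _*ᶜ_
  infix  8 -ᶜ_

  _+ᶜ_ _*ᶜ_ : ℂ → ℂ → ℂ
  (a +i b) +ᶜ (c +i d) = (a +ᴿ c) +i (b +ᴿ d)
  (a +i b) *ᶜ (c +i d) = (a *ᴿ c +ᴿ -ᴿ (b *ᴿ d)) +i (a *ᴿ d +ᴿ b *ᴿ c)

  -ᶜ_ : ℂ → ℂ
  -ᶜ (a +i b) = (-ᴿ a) +i (-ᴿ b)

  0ᶜ 1ᶜ : ℂ
  0ᶜ = 0ᴿ +i 0ᴿ
  1ᶜ = 1ᴿ +i 0ᴿ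

  isCommutativeRing : IsCommutativeRing _≈_ _+ᶜ_ _*ᶜ_ -ᶜ_ 0ᶜ 1ᶜ
  isCommutativeRing = record
    { isRing = record
      { +-isAbelianGroup = record
        { isGroup = record
          { isMonoid = record
            { isSemigroup = record
              { isMagma = record
                { isEquivalence = record
                  { refl  = R.refl , R.refl
                  ; sym   = λ (p , q) → R.sym p , R.sym q
                  ; trans = λ (p , q) (p′ , q′) → R.trans p p′ , R.trans q q′
                  }
                ; ∙-cong = λ (p , q) (p′ , q′) → R.+-cong p p′ , R.+-cong q q′
                }
              ; assoc = λ x y z → R.+-assoc (re x) (re y) (re z) , R.+-assoc (im x) (im y) (im z)
              }
            ; identity = (λ x → R.+-identityˡ (re x) , R.+-identityˡ (im x)) , (λ x → R.+-identityʳ (re x) , R.+-identityʳ (im x))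
            }
          ; inverse = (λ x → R.-‿inverseˡ (re x) , R.-‿inverseˡ (im x)) , (λ x → R.-‿inverseʳ (re x) , R.-‿inverseʳ (im x))
          ; ⁻¹-cong = λ (p , q) → R.-‿cong p , R.-‿cong q
          }
        ; comm = λ x y → R.+-comm (re x) (re y) , R.+-comm (im x) (im y)
        }
      ; *-cong = λ (p , q) (p′ , q′) →
          R.+-cong (R.*-cong p p′) (R.-‿cong (R.*-cong q q′)) , R.+-cong (R.*-cong p q′) (R.*-cong q p′)
      ; *-assoc = λ (a +i b) (c +i d) (e +i f) →
          pointwise⇒≈ (λ n → solve 6 (λ a b c d e f →
            (a :* c :- b :* d) :* e :- (a :* d :+ b :* c) :* f := a :* (c :* e :- d :* f) :- b :* (c :* f :+ d :* e))
            refl (seq a n) (seq b n) (seq c n) (seq d n) (seq e n) (seq f n)) ,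
          pointwise⇒≈ (λ n → solve 6 (λ a b c d e f →
            (a :* c :- b :* d) :* f :+ (a :* d :+ b :* c) :* e := a :* (c :* f :+ d :* e) :+ b :* (c :* e :- d :* f))
            refl (seq a n) (seq b n) (seq c n) (seq d n) (seq e n) (seq f n))
      ; *-identity =
          (λ (a +i b) →
            pointwise⇒≈ (λ n → solve 2 (λ a b → con 1ℚ :* a :- con 0ℚ :* b := a) refl (seq a n) (seq b n)) ,
            pointwise⇒≈ (λ n → solve 2 (λ a b → con 1ℚ :* b :+ con 0ℚ :* a := b) refl (seq a n) (seq b n))) ,
          (λ (a +i b) →
            pointwise⇒≈ (λ n → solve 2 (λ a b → a :* con 1ℚ :- b :* con 0ℚ := a) refl (seq a n) (seq b n)) ,
            pointwise⇒≈ (λ n → solve 2 (λ a b → a :* con 0ℚ :+ b :* con 1ℚ := b) refl (seq a n) (seq b n)))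
      ; distrib =
          (λ (a +i b) (c +i d) (e +i f) →
            pointwise⇒≈ (λ n → solve 6 (λ a b c d e f →
              a :* (c :+ e) :- b :* (d :+ f) := (a :* c :- b :* d) :+ (a :* e :- b :* f))
              refl (seq a n) (seq b n) (seq c n) (seq d n) (seq e n) (seq f n)) ,
            pointwise⇒≈ (λ n → solve 6 (λ a b c d e f →
              a :* (d :+ f) :+ b :* (c :+ e) := (a :* d :+ b :* c) :+ (a :* f :+ b :* e))
              refl (seq a n) (seq b n) (seq c n) (seq d n) (seq e n) (seq f n))) ,
          (λ (a +i b) (c +i d) (e +i f) →
            pointwise⇒≈ (λ n → solve 6 (λ a b c d e f →
              (c :+ e) :* a :- (d :+ f) :* b := (c :* a :- d :* b) :+ (e :* a :- f :* b))
              refl (seq a n) (seq b n) (seq c n) (seq d n) (seq e n) (seq f n)) ,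
            pointwise⇒≈ (λ n → solve 6 (λ a b c d e f →
              (c :+ e) :* b :+ (d :+ f) :* a := (c :* b :+ d :* a) :+ (e :* b :+ f :* a))
              refl (seq a n) (seq b n) (seq c n) (seq d n) (seq e n) (seq f n)))
      }
    ; *-comm = λ (a +i b) (c +i d) →
        pointwise⇒≈ (λ n → solve 4 (λ a b c d → a :* c :- b :* d := c :* a :- d :* b)
          refl (seq a n) (seq b n) (seq c n) (seq d n)) ,
        pointwise⇒≈ (λ n → solve 4 (λ a b c d → a :* d :+ b :* c := c :* b :+ d :* a)
          refl (seq a n) (seq b n) (seq c n) (seq d n))
    }

  commutativeRing : CommutativeRing 0ℓ 0ℓ
  commutativeRing = record { isCommutativeRing = isCommutativeRing }

  private
    module C = CommutativeRing commutativeRing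

    ∣z-w∣²#0 : ∀ z w → z # w → let u = re (z +ᶜ -ᶜ w) ; v = im (z +ᶜ -ᶜ w) in u *ᴿ u +ᴿ v *ᴿ v R.# 0ᴿ
    ∣z-w∣²#0 z w (inj₁ p) = Real.x#0⇒x²+y²#0 (im (z +ᶜ -ᶜ w)) (Real.x#y⇒x-y#0 p)
    ∣z-w∣²#0 z w (inj₂ p) = #-congʳ {y *ᴿ y +ᴿ x *ᴿ x} {x *ᴿ x +ᴿ y *ᴿ y} (R.+-comm (y *ᴿ y) (x *ᴿ x))
      (Real.x#0⇒x²+y²#0 {y} x (Real.x#y⇒x-y#0 p))
      where
      open HeytingProperties R.heytingCommutativeRing using (#-congʳ)
      x = re (z +ᶜ -ᶜ w)
      y = im (z +ᶜ -ᶜ w)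

    inverse : ∀ {z w} → z # w → ∃ λ v → (z +ᶜ -ᶜ w) *ᶜ v ≈ 1ᶜ
    inverse {z} {w} z#w =
      let x = re (z +ᶜ -ᶜ w)
          y = im (z +ᶜ -ᶜ w)
          r , e = Real.inverse (∣z-w∣²#0 z w z#w)
      in ((x *ᴿ r) +i (-ᴿ (y *ᴿ r))) ,
         R.trans (pointwise⇒≈ (λ n → solve 3 (λ x y r →
           x :* (x :* r) :- y :* (:- (y :* r)) := ((x :* x :+ y :* y) :- con 0ℚ) :* r)
           refl (seq x n) (seq y n) (seq r n))) e ,
         pointwise⇒≈ (λ n → solve 3 (λ x y r → x :* (:- (y :* r)) :+ y :* (x :* r) := con 0ℚ)
           refl (seq x n) (seq y n) (seq r n))

    summand-invertible : ∀ x y p q → x *ᴿ p +ᴿ -ᴿ (y *ᴿ q) R.≈ 1ᴿ →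
      (∃ λ w → x *ᴿ w R.≈ 1ᴿ) ⊎ (∃ λ w → y *ᴿ w R.≈ 1ᴿ)
    summand-invertible x y p q e = decide (R.#-cotrans 1#0 (x *ᴿ p))
      where
      open HeytingProperties R.heytingCommutativeRing using (1#0)

      decide : 1ᴿ R.# x *ᴿ p ⊎ x *ᴿ p R.# 0ᴿ → (∃ λ w → x *ᴿ w R.≈ 1ᴿ) ⊎ (∃ λ w → y *ᴿ w R.≈ 1ᴿ)
      decide (inj₁ 1#xp) = let r , e′ = Real.inverse 1#xp in
        inj₂ (-ᴿ (q *ᴿ r) ,
          R.trans (pointwise⇒≈ (λ n → solve 5 (λ x y p q r →
            y :* (:- (q :* r)) := ((x :* p :- y :* q) :- x :* p) :* r)
            refl (seq x n) (seq y n) (seq p n) (seq q n) (seq r n)))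
          (R.trans (R.*-cong {_} {1ᴿ +ᴿ -ᴿ (x *ᴿ p)} {r} {r}
            (R.+-cong {_} {1ᴿ} { -ᴿ (x *ᴿ p)} {_} e R.refl) R.refl) e′))
      decide (inj₂ xp#0) = let r , e′ = Real.inverse xp#0 in
        inj₁ (p *ᴿ r ,
          R.trans (pointwise⇒≈ (λ n → solve 3 (λ x p r → x :* (p :* r) := (x :* p :- con 0ℚ) :* r)
            refl (seq x n) (seq p n) (seq r n))) e′)

    invertible⇒# : ∀ {z w v} → (z +ᶜ -ᶜ w) *ᶜ v ≈ 1ᶜ → z # w
    invertible⇒# {z} {w} {p +i q} (e , _) =
      Sum.map (λ (r , e′) → Real.invertible⇒# {re z} {re w} {r} e′) (λ (r , e′) → Real.invertible⇒# {im z} {im w} {r} e′)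
        (summand-invertible (re (z +ᶜ -ᶜ w)) (im (z +ᶜ -ᶜ w)) p q e)

    #-cotrans : ∀ {z w} → z # w → ∀ v → z # v ⊎ v # w
    #-cotrans (inj₁ p) v = Sum.map inj₁ inj₁ (R.#-cotrans p (re v))
    #-cotrans (inj₂ p) v = Sum.map inj₂ inj₂ (R.#-cotrans p (im v))

    ≈⇒¬# : ∀ {z w} → z ≈ w → ¬ z # w
    ≈⇒¬# (e , _) (inj₁ p) = R.#-irrefl e p
    ≈⇒¬# (_ , e) (inj₂ p) = R.#-irrefl e p

  heytingField : HeytingField 0ℓ 0ℓ 0ℓ
  heytingField = record
    { _≈_ = _≈_ ; _#_ = _#_ ; _+_ = _+ᶜ_ ; _*_ = _*ᶜ_ ; -_ = -ᶜ_ ; 0# = 0ᶜ ; 1# = 1ᶜ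
    ; isHeytingField = record
      { isHeytingCommutativeRing = record
        { isCommutativeRing   = isCommutativeRing
        ; isApartnessRelation = record
          { irrefl  = ≈⇒¬#
          ; sym     = Sum.map R.#-sym R.#-sym
          ; cotrans = #-cotrans
          }
        ; #⇒invertible = λ {z} {w} z#w → let v , e = inverse {z} {w} z#w in
            v , C.trans {v *ᶜ (z +ᶜ -ᶜ w)} {(z +ᶜ -ᶜ w) *ᶜ v} {1ᶜ} (C.*-comm v (z +ᶜ -ᶜ w)) e , e
        ; invertible⇒# = λ {z} {w} (v , _ , e) → invertible⇒# {z} {w} {v} e
        }
      ; tight = λ z w →
          (λ ¬z#w → proj₁ (R.tight (re z) (re w)) (λ p → ¬z#w (inj₁ p)) ,
                     proj₁ (R.tight (im z) (im w)) (λ p → ¬z#w (inj₂ p))) , ≈⇒¬#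
      }
    }

  open RawMonoidDefs (CommutativeRing.+-rawMonoid commutativeRing) using () renaming (_×_ to _·_)

  n·1ᶜ#0 : ∀ n .{{_ : NonZero n}} → n · 1ᶜ # 0ᶜ
  n·1ᶜ#0 n = inj₁ (subst (R._# 0ᴿ) (sym (re-n·1 n)) (n·1#0 n))
    where
    re-n·1 : ∀ n → re (n · 1ᶜ) ≡ RawMonoidDefs._×_ (CommutativeRing.+-rawMonoid Real.commutativeRing) n 1ᴿ
    re-n·1 zero    = refl
    re-n·1 (suc n) = cong (1ᴿ +ᴿ_) (re-n·1 n)

module _ (a b : ℕ) where

  Representable : ℕ → Set
  Representable n = ∃₂ λ x y → n ≡ a ℕ.* x ℕ.+ b ℕ.* y

  module _ .{{_ : NonZero a}} .{{_ : NonZero b}} where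

    representable? : ∀ n → Dec (Representable n)
    representable? n = map′
      (λ { (x , _ , y , _ , e) → x , y , e })
      (λ { (x , y , refl) →
        x , ℕ.s≤s (ℕ.≤-trans (ℕ.m≤n*m x a) (ℕ.m≤m+n (a ℕ.* x) (b ℕ.* y))) ,
        y , ℕ.s≤s (ℕ.≤-trans (ℕ.m≤n*m y b) (ℕ.m≤n+m (b ℕ.* y) (a ℕ.* x))) , refl })
      (ℕ.anyUpTo? (λ x → ℕ.anyUpTo? (λ y → n ℕ.≟ a ℕ.* x ℕ.+ b ℕ.* y) (suc n)) (suc n))

    -- For coprime a and b the bound a * b loses nothing: see ∈-NR.
    NR : List ℕ
    NR = filter (¬? ∘ representable?) (upTo (a ℕ.* b))

    NR-unique : Unique NR
    NR-unique = Unique.filter⁺ (¬? ∘ representable?) (Unique.upTo⁺ (a ℕ.* b))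

private

  -- From n = n * (u * a - v * b), the remainder X of n * u modulo b satisfies
  -- a * X ≤ n and b ∣ n - a * X.
  ab≤n⇒representable : ∀ a b n .{{_ : NonZero b}} u v → 1 ℕ.+ v ℕ.* b ≡ u ℕ.* a →
    a ℕ.* b ℕ.≤ n → Representable a b n
  ab≤n⇒representable a b n u v e ab≤n = X , ℕ.quotient b∣n∸aX ,
    trans (sym (ℕ.m+[n∸m]≡n aX≤n))
      (cong (a ℕ.* X ℕ.+_) (trans (ℕ._∣_.equality b∣n∸aX) (ℕ.*-comm (ℕ.quotient b∣n∸aX) b)))
    where
    X Q : ℕ
    X = (n ℕ.* u) ℕ.% b
    Q = (n ℕ.* u) ℕ./ b

    aX≤n : a ℕ.* X ℕ.≤ n
    aX≤n = ℕ.≤-trans (ℕ.*-monoʳ-≤ a (ℕ.<⇒≤ (ℕ.m%n<n (n ℕ.* u) b))) ab≤n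

    n+nvb≡aX+aQb : n ℕ.+ n ℕ.* v ℕ.* b ≡ a ℕ.* X ℕ.+ a ℕ.* Q ℕ.* b
    n+nvb≡aX+aQb = begin
      n ℕ.+ n ℕ.* v ℕ.* b          ≡⟨ lemma₁ n v b ⟩
      n ℕ.* (1 ℕ.+ v ℕ.* b)        ≡⟨ cong (n ℕ.*_) e ⟩
      n ℕ.* (u ℕ.* a)              ≡⟨ lemma₂ n u a ⟩
      a ℕ.* (n ℕ.* u)              ≡⟨ cong (a ℕ.*_) (ℕ.m≡m%n+[m/n]*n (n ℕ.* u) b) ⟩
      a ℕ.* (X ℕ.+ Q ℕ.* b)        ≡⟨ lemma₃ a X Q b ⟩
      a ℕ.* X ℕ.+ a ℕ.* Q ℕ.* b    ∎
      where
      open ≡-Reasoning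
      lemma₁ : ∀ n v b → n ℕ.+ n ℕ.* v ℕ.* b ≡ n ℕ.* (1 ℕ.+ v ℕ.* b)
      lemma₁ = ℕ-solver.solve-∀
      lemma₂ : ∀ n u a → n ℕ.* (u ℕ.* a) ≡ a ℕ.* (n ℕ.* u)
      lemma₂ = ℕ-solver.solve-∀
      lemma₃ : ∀ a X Q b → a ℕ.* (X ℕ.+ Q ℕ.* b) ≡ a ℕ.* X ℕ.+ a ℕ.* Q ℕ.* b
      lemma₃ = ℕ-solver.solve-∀

    b∣n∸aX : b ℕ.∣ n ∸ a ℕ.* X
    b∣n∸aX = ℕ.∣m+n∣m⇒∣n
      (subst (b ℕ.∣_) (sym eq) (ℕ.n∣m*n (a ℕ.* Q))) (ℕ.n∣m*n (n ℕ.* v))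
      where
      eq : n ℕ.* v ℕ.* b ℕ.+ (n ∸ a ℕ.* X) ≡ a ℕ.* Q ℕ.* b
      eq = trans (sym (ℕ.+-∸-assoc (n ℕ.* v ℕ.* b) aX≤n))
        (trans (cong (_∸ a ℕ.* X) (trans (ℕ.+-comm (n ℕ.* v ℕ.* b) n) n+nvb≡aX+aQb)) (ℕ.m+n∸m≡n (a ℕ.* X) _))

  coprime⇒ab≤n⇒representable : ∀ a b n .{{_ : NonZero a}} .{{_ : NonZero b}} → gcd a b ≡ 1 →
    a ℕ.* b ℕ.≤ n → Representable a b n
  coprime⇒ab≤n⇒representable a b n g≡1 ab≤n with Bézout.identity (subst (GCD a b) g≡1 (gcd-GCD a b))
  ... | Bézout.+- u v e = ab≤n⇒representable a b n u v e ab≤n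
  ... | Bézout.-+ u v e =
    let y , x , n≡ = ab≤n⇒representable b a n v u e (subst (ℕ._≤ n) (ℕ.*-comm a b) ab≤n)
    in x , y , trans n≡ (ℕ.+-comm (b ℕ.* y) (a ℕ.* x))

∈-NR : ∀ a b .{{_ : NonZero a}} .{{_ : NonZero b}} → gcd a b ≡ 1 → ∀ n → n ∈ NR a b ⇔ (¬ Representable a b n)
∈-NR a b g≡1 n = mk⇔
  (λ n∈NR → proj₂ (∈-filter⁻ (¬? ∘ representable? a b) {xs = upTo (a ℕ.* b)} n∈NR))
  (λ ¬rep → ∈-filter⁺ (¬? ∘ representable? a b)
    (∈-upTo⁺ (ℕ.≰⇒> (λ ab≤n → ¬rep (coprime⇒ab≤n⇒representable a b n g≡1 ab≤n)))) ¬rep)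

CharacteristicZero : ∀ {c ℓ₁ ℓ₂} → HeytingField c ℓ₁ ℓ₂ → Set ℓ₂
CharacteristicZero K = ∀ n .{{_ : NonZero n}} → RawMonoidDefs._×_ +-rawMonoid n 1# # 0#
  where
  open HeytingField K
  open CommutativeRing (HeytingCommutativeRing.commutativeRing heytingCommutativeRing) using (+-rawMonoid)

module ApostolBernoulli {c ℓ₁ ℓ₂} (K : HeytingField c ℓ₁ ℓ₂) (char0 : CharacteristicZero K) where

  open HeytingField K public using (Carrier; _≈_; _#_; _+_; _*_; -_; _-_; 0#; 1#)

  private
    module K = HeytingField K
    open HeytingProperties K.heytingCommutativeRing
    commutativeRing = HeytingCommutativeRing.commutativeRing K.heytingCommutativeRing
    open CommutativeRing commutativeRing using (semiring; +-rawMonoid; +-commutativeMonoid; setoid; ring)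
    open RawMonoidDefs +-rawMonoid using () renaming (_×_ to _·_)
    open Sums +-commutativeMonoid using (sum; sum-cong-≗; sum-cong-≋)
    open RingProperties ring using (-‿distribʳ-*)
    open SetoidReasoning setoid

  open Exponentiation semiring public using (_^_)

  infix 10 _!ˣ
  infix 9 _⁻¹
  infixl 7 _/_ _·ˣ_
  infixr 8 _^ᶻ_

  fromℕ : ℕ → Carrier
  fromℕ n = n · 1#

  Nonzero : Set (c ⊔ ℓ₂)
  Nonzero = Σ Carrier (_# 0#)

  ⟨_⟩ : ∀ n .{{_ : NonZero n}} → Nonzero
  ⟨ n ⟩ = fromℕ n , char0 n

  _!ˣ : ℕ → Nonzero
  n !ˣ = ⟨ n ! ⟩ {{n ℕ.!≢0}}

  _·ˣ_ : Nonzero → Nonzero → Nonzero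
  (x , x#0) ·ˣ (y , y#0) = x * y , x#0y#0→xy#0 x#0 y#0

  _⁻¹ : Nonzero → Carrier
  (x , x#0) ⁻¹ = proj₁ (K.#⇒invertible x#0)

  *-inverseʳ : ∀ x → proj₁ x * x ⁻¹ ≈ 1#
  *-inverseʳ (x , x#0) = K.trans (K.*-congʳ (K.sym (x-0≈x x))) (proj₂ (proj₂ (K.#⇒invertible x#0)))

  _/_ : Carrier → Nonzero → Carrier
  x / y = x * y ⁻¹

  _^ᶻ_ : Nonzero → ℤ → Carrier
  x ^ᶻ (+ n)    = proj₁ x ^ n
  x ^ᶻ -[1+ n ] = x ⁻¹ ^ suc n

  ∑≤ : ℕ → (ℕ → Carrier) → Carrier
  ∑≤ n f = sum {suc n} (f ∘ toℕ)

  syntax ∑≤ n (λ i → x) = ∑[ i ≤ n ] x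

  ∑∈ : List ℕ → (ℕ → Carrier) → Carrier
  ∑∈ ns f = foldr _+_ 0# (map f ns)

  syntax ∑∈ ns (λ n → x) = ∑[ n ∈ ns ] x

  -- The expansion of z / (μ eᶻ - 1) at 0 is taken in formal power series, given
  -- by their coefficient sequences.
  PowerSeries : Set c
  PowerSeries = ℕ → Carrier

  _⊛_ : PowerSeries → PowerSeries → PowerSeries
  (f ⊛ g) n = ∑[ k ≤ n ] (f k * g (n ∸ k))

  -- The series q with f ⊛ q = g, for f with invertible constant term, from
  -- qₙ = (gₙ - ∑_{k<n} f_{k+1} q_{n-1-k}) / f₀.
  module Quotient (g f : PowerSeries) (f₀#0 : f 0 # 0#) where

    -- qₙ₋₁ ∷ … ∷ q₀ ∷ []
    previous : ∀ n → Vec Carrier n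
    previous zero    = []
    previous (suc n) =
      (g n - sum (λ (k : Fin n) → f (suc (toℕ k)) * lookup (previous n) k)) / (f 0 , f₀#0) ∷ previous n

    quotient : PowerSeries
    quotient n = head (previous (suc n))

    private

      lookup-previous : ∀ n (k : Fin n) → lookup (previous n) k ≡ quotient (n ∸ suc (toℕ k))
      lookup-previous (suc n) zero    = refl
      lookup-previous (suc n) (suc k) = lookup-previous n k

    ⊛-quotient : ∀ n → (f ⊛ quotient) n ≈ g n
    ⊛-quotient n = begin
      f 0 * ((g n - s) * f₀⁻¹) + sum (λ (k : Fin n) → f (suc (toℕ k)) * quotient (n ∸ suc (toℕ k)))
        ≡⟨ cong (λ t → f 0 * ((g n - s) * f₀⁻¹) + t) (sum-cong-≗ (λ k → cong (f (suc (toℕ k)) *_) (sym (lookup-previous n k)))) ⟩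
      f 0 * ((g n - s) * f₀⁻¹) + s    ≈⟨ K.+-congʳ (K.*-congˡ (K.*-comm (g n - s) f₀⁻¹)) ⟩
      f 0 * (f₀⁻¹ * (g n - s)) + s    ≈⟨ K.+-congʳ (K.*-assoc (f 0) f₀⁻¹ (g n - s)) ⟨
      f 0 * f₀⁻¹ * (g n - s) + s      ≈⟨ K.+-congʳ (K.*-congʳ (*-inverseʳ (f 0 , f₀#0))) ⟩
      1# * (g n - s) + s              ≈⟨ K.+-congʳ (K.*-identityˡ (g n - s)) ⟩
      (g n - s) + s                   ≈⟨ K.+-assoc (g n) (- s) s ⟩
      g n + (- s + s)                 ≈⟨ K.+-congˡ (K.-‿inverseˡ s) ⟩
      g n + 0#                        ≈⟨ K.+-identityʳ (g n) ⟩
      g n                             ∎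
      where
      s    = sum (λ (k : Fin n) → f (suc (toℕ k)) * lookup (previous n) k)
      f₀⁻¹ = (f 0 , f₀#0) ⁻¹

  1ˢ zˢ expˢ : PowerSeries
  1ˢ zero    = 1#
  1ˢ (suc _) = 0#
  zˢ (suc zero) = 1#
  zˢ _          = 0#
  expˢ n = n !ˣ ⁻¹

  -- The series μ eᶻ - 1.
  denominator : Carrier → PowerSeries
  denominator μ n = μ * expˢ n - 1ˢ n

  denominator₀#0 : ∀ {μ} → μ # 1# → denominator μ 0 # 0#
  denominator₀#0 {μ} μ#1 = #-congʳ
    (K.+-congʳ (K.trans (K.sym (K.*-identityʳ μ)) (K.*-congˡ (K.sym exp₀≈1)))) μ-1#0
    where
    exp₀≈1 : expˢ 0 ≈ 1#
    exp₀≈1 = K.trans (K.sym (K.*-identityˡ (expˢ 0)))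
      (K.trans (K.*-congʳ (K.sym (K.+-identityʳ 1#))) (*-inverseʳ ⟨ 1 ⟩))

    μ-1#0 : μ - 1# # 0#
    μ-1#0 = let w , l , _ = K.#⇒invertible μ#1 in
      invertibleˡ⇒# (w , K.trans (K.*-congˡ (x-0≈x (μ - 1#))) l)

  -- 𝓑 n μ is n! times the n-th coefficient of z / (μ eᶻ - 1); the proof of μ # 1
  -- is what makes the constant term of the denominator invertible.
  𝓑 : ℕ → (μ : Carrier) → μ # 1# → Carrier
  𝓑 n μ μ#1 = fromℕ (n !) * Quotient.quotient zˢ (denominator μ) (denominator₀#0 μ#1) n

  𝓑-generating : ∀ μ (μ#1 : μ # 1#) n →
    (denominator μ ⊛ λ k → 𝓑 k μ μ#1 / k !ˣ) n ≈ zˢ n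
  𝓑-generating μ μ#1 n = K.trans
    (sum-cong-≋ {suc n} (λ k → K.*-congˡ {denominator μ (toℕ k)} (𝓑/!≈quotient (n ∸ toℕ k))))
    (Quotient.⊛-quotient zˢ (denominator μ) (denominator₀#0 μ#1) n)
    where
    𝓑/!≈quotient : ∀ k → 𝓑 k μ μ#1 / k !ˣ ≈ Quotient.quotient zˢ (denominator μ) (denominator₀#0 μ#1) k
    𝓑/!≈quotient k = begin
      fromℕ (k !) * q * k!⁻¹    ≈⟨ K.*-congʳ (K.*-comm (fromℕ (k !)) q) ⟩
      q * fromℕ (k !) * k!⁻¹    ≈⟨ K.*-assoc q (fromℕ (k !)) k!⁻¹ ⟩
      q * (fromℕ (k !) * k!⁻¹)  ≈⟨ K.*-congˡ (*-inverseʳ (k !ˣ)) ⟩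
      q * 1#                    ≈⟨ K.*-identityʳ q ⟩
      q                         ∎
      where
      q    = Quotient.quotient zˢ (denominator μ) (denominator₀#0 μ#1) k
      k!⁻¹ = k !ˣ ⁻¹

  ^#1⇒#1 : ∀ {x} n → x ^ n # 1# → x # 1#
  ^#1⇒#1 zero    p = ⊥-elim (K.#-irrefl K.refl p)
  ^#1⇒#1 {x} (suc n) p with K.#-cotrans p (x ^ n)
  ... | inj₂ q = ^#1⇒#1 n q
  ... | inj₁ q = let w , l , _ = K.#⇒invertible q in invertibleˡ⇒# (w * x ^ n , (begin
    w * x ^ n * (x - 1#)           ≈⟨ K.*-assoc w (x ^ n) (x - 1#) ⟩
    w * (x ^ n * (x - 1#))         ≈⟨ K.*-congˡ (K.distribˡ (x ^ n) x (- 1#)) ⟩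
    w * (x ^ n * x + x ^ n * - 1#) ≈⟨ K.*-congˡ (K.+-cong (K.*-comm (x ^ n) x)
                                        (K.trans (K.sym (-‿distribʳ-* (x ^ n) 1#)) (K.-‿cong (K.*-identityʳ (x ^ n))))) ⟩
    w * (x * x ^ n - x ^ n)        ≈⟨ l ⟩
    1#                             ∎))

  -- Elements of NR a b are positive since 0 is representable, so n - 1 ≥ 0.
  S : ℕ → Nonzero → (a b : ℕ) .{{_ : NonZero a}} .{{_ : NonZero b}} → Carrier
  S m ƛ a b = ∑[ n ∈ NR a b ] (ƛ ^ᶻ (+ n ℤ.- 1ℤ) * fromℕ n ^ m)

-- Opaque so that the statement is compared without unfolding Cauchy sequences.
opaque

  ℂ-field : HeytingField 0ℓ 0ℓ 0ℓ
  ℂ-field = Complex.heytingField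

  ℂ-char0 : CharacteristicZero ℂ-field
  ℂ-char0 = Complex.n·1ᶜ#0

open ApostolBernoulli ℂ-field ℂ-char0 public renaming (Carrier to ℂ)

-- Put x = ƛ eᶻ, G = ∑ xⁿ over n in NR a b, and β_c(z) = c z / (ƛᶜ eᶜᶻ - 1).
-- Each residue class modulo b contains exactly one a i with i < b, namely its
-- least representable element, so
--   (xᵇ - 1) G = ∑_{i<b} xᵃⁱ - ∑_{r<b} xʳ.
-- Summing the geometric series and multiplying by β_a, β_b and β_1 to clear
-- the denominators gives
--   a b z² G + a b z β_1 + β_a β_b = xᵃᵇ β_a β_b.
-- The formula is m! / (a b ƛ) times the coefficient of zᵐ⁺².

module Submission where

open import Algebra.Apartness.Bundles using (HeytingCommutativeRing; HeytingField)
open import Algebra.Bundles using (CommutativeRing)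
import Algebra.Construct.Pointwise as Pointwise
import Algebra.Properties.AbelianGroup as AbelianGroupProperties
import Algebra.Properties.CommutativeSemigroup as CommutativeSemigroupProperties
import Algebra.Properties.CommutativeSemiring.Binomial as Binomial
import Algebra.Properties.CommutativeSemiring.Exp as Exp
import Algebra.Properties.Semiring.Mult as Mult
import Algebra.Properties.Semiring.Sum as Sum
import Algebra.Solver.Ring.NaturalCoefficients.Default as RingSolver
open import Data.Empty using (⊥-elim)
open import Data.Fin.Base using (Fin; zero; suc; toℕ)
import Data.Fin.Properties as Fin
open import Data.Integer.Base as ℤ using (+_; 1ℤ)
import Data.Integer.Properties as ℤ
import Data.Integer.Tactic.RingSolver as ℤ-solver
open import Data.List.Base using (List; []; _∷_; _++_; applyUpTo; foldr; map; upTo)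
import Data.List.Properties as List
open import Data.List.Membership.Propositional using (_∈_)
open import Data.List.Membership.Propositional.Properties
  using (∈-++⁺ˡ; ∈-++⁺ʳ; ∈-++⁻; ∈-map⁺; ∈-map⁻; ∈-upTo⁺; ∈-upTo⁻)
open import Data.List.Membership.Propositional.Properties.WithK using (unique∧set⇒bag)
open import Data.List.Relation.Binary.BagAndSetEquality using (∼bag⇒↭)
open import Data.List.Relation.Binary.Permutation.Propositional as Perm using (_↭_)
import Data.List.Relation.Unary.Unique.Propositional.Properties as Unique
open import Data.Nat.Base as ℕ using (ℕ; zero; suc; NonZero; _∸_; _!)
open import Data.Nat.Combinatorics using (_C_)
import Data.Nat.Combinatorics as ℕ
import Data.Nat.Coprimality as Coprimality
import Data.Nat.Divisibility as ℕ
import Data.Nat.DivMod as ℕ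
open import Data.Nat.GCD using (gcd)
import Data.Nat.Properties as ℕ
import Data.Nat.Tactic.RingSolver as ℕ-solver
open import Data.Product.Base using (_×_; _,_; proj₁)
open import Data.Sum.Base using (inj₁; inj₂)
open import Function.Base using (_∘_)
open import Function.Bundles using (module Equivalence; mk⇔)
open import Relation.Binary.PropositionalEquality
  using (_≡_; refl; sym; trans; cong; subst; module ≡-Reasoning)
import Relation.Binary.Reasoning.Setoid as SetoidReasoning
open import Relation.Nullary.Decidable using (yes; no)
open import Relation.Nullary.Negation using (¬_)
import Defs

-- Since ∑_{i<b} xᵃⁱ = (xᵃᵇ - 1)/(xᵃ - 1) and ∑_{r<b} xʳ = (xᵇ - 1)/(x - 1), the closed form behind
-- everything is G = (xᵃᵇ - 1)/((xᵃ - 1)(xᵇ - 1)) - 1/(x - 1). No quotient of series is formed after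
-- β_c: each β_c enters only through (xᶜ - 1) β_c = c z, so a denominator is removed by
-- multiplication, with every relation arranged free of subtraction. The one division left, by z, is
-- a shift of coefficients. The coefficient of zᵐ⁺² is the right one because G carries z², and G at
-- zᵐ is S up to the factor m!/ƛ. Both β_a and β_b lack a constant term, so β_a β_b starts at z²;
-- this is why the double sum runs over ℓ from 0 to m with ℓ + 2 as the inner bound. The argument
-- works over any Heyting field of characteristic zero, where a, b and all factorials have inverses.

private

  b+[ax+by] : ∀ a b x y → b ℕ.+ (a ℕ.* x ℕ.+ b ℕ.* y) ≡ a ℕ.* x ℕ.+ b ℕ.* suc y
  b+[ax+by] = ℕ-solver.solve-∀

-- Nonrepresentable numbers and their shift by b

module _ (a b : ℕ) .{{_ : NonZero a}} .{{_ : NonZero b}} (coprime : gcd a b ≡ 1) where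

  open Defs using (Representable; representable?; NR; NR-unique; ∈-NR)

  private

    ∈NR⁺ : ∀ {n} → ¬ Representable a b n → n ∈ NR a b
    ∈NR⁺ {n} = Equivalence.from (∈-NR a b coprime n)

    ∈NR⁻ : ∀ {n} → n ∈ NR a b → ¬ Representable a b n
    ∈NR⁻ {n} = Equivalence.to (∈-NR a b coprime n)

    a·representable : ∀ i → Representable a b (a ℕ.* i)
    a·representable i = i , 0 , sym (trans (cong (a ℕ.* i ℕ.+_) (ℕ.*-zeroʳ b)) (ℕ.+-identityʳ _))

    b+representable : ∀ {n} → Representable a b n → Representable a b (b ℕ.+ n)
    b+representable {n} (x , y , refl) = x , suc y , b+[ax+by] a b x y

  -- If i ≤ x, then b + a x + b y is too large. Otherwise a (i - x) = b (1 + y), so b divides i - x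
  -- by coprimality, while 0 < i - x ≤ i < b.
  ai≢b+representable : ∀ {i n} → i ℕ.< b → a ℕ.* i ≡ b ℕ.+ n → ¬ Representable a b n
  ai≢b+representable {i} i<b ai≡b+n (x , y , refl) with ℕ.≤-total i x
  ... | inj₁ i≤x = ℕ.<-irrefl ai≡b+n (ℕ.≤-<-trans
          (ℕ.≤-trans (ℕ.*-monoʳ-≤ a i≤x) (ℕ.m≤m+n (a ℕ.* x) (b ℕ.* y)))
          (ℕ.m<n+m _ (ℕ.>-nonZero⁻¹ b)))
  ... | inj₂ x≤i with ℕ.m≤n⇒∃[o]m+o≡n x≤i
  ... | d , refl = ℕ.<-irrefl refl (ℕ.<-≤-trans i<b
          (ℕ.≤-trans (ℕ.∣⇒≤ {{d≢0}} b∣d) (ℕ.m≤n+m d x)))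
    where
    ad≡b[1+y] : a ℕ.* d ≡ b ℕ.* suc y
    ad≡b[1+y] = ℕ.+-cancelˡ-≡ (a ℕ.* x) _ _
      (trans (sym (ℕ.*-distribˡ-+ a x d)) (trans ai≡b+n (b+[ax+by] a b x y)))

    b∣d : b ℕ.∣ d
    b∣d = Coprimality.coprime-divisor (Coprimality.sym (Coprimality.gcd≡1⇒coprime {a} coprime))
      (subst (b ℕ.∣_) (sym ad≡b[1+y]) (ℕ.m∣m*n (suc y)))

    d≢0 : NonZero d
    d≢0 = ℕ.m*n≢0⇒n≢0 a {{subst NonZero (sym ad≡b[1+y]) (ℕ.m*n≢0 b (suc y))}}

  -- The numbers a * i with i < b are the least representable ones in their
  -- classes modulo b, so shifting NR by b trades them for upTo b.
  NR-shift : NR a b ++ map (a ℕ.*_) (upTo b) ↭ upTo b ++ map (b ℕ.+_) (NR a b)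
  NR-shift = ∼bag⇒↭ (unique∧set⇒bag
    (Unique.++⁺ (NR-unique a b) (Unique.map⁺ (ℕ.*-cancelˡ-≡ _ _ a) (Unique.upTo⁺ b))
      λ (n∈NR , n∈a·) → let i , _ , n≡ai = ∈-map⁻ (a ℕ.*_) n∈a· in
        ∈NR⁻ n∈NR (subst (Representable a b) (sym n≡ai) (a·representable i)))
    (Unique.++⁺ (Unique.upTo⁺ b) (Unique.map⁺ (ℕ.+-cancelˡ-≡ b _ _) (NR-unique a b))
      λ (n∈upTo , n∈b+) → let k , _ , n≡b+k = ∈-map⁻ (b ℕ.+_) n∈b+ in
        ℕ.<-irrefl n≡b+k (ℕ.<-≤-trans (∈-upTo⁻ n∈upTo) (ℕ.m≤m+n b k)))
    (mk⇔ to from))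
    where
    A = map (a ℕ.*_) (upTo b)
    B = map (b ℕ.+_) (NR a b)

    -- Either n < b or b can be subtracted; the hypothesis speaks only about the second case.
    <b∨b+NR : ∀ {n} → (∀ {k} → n ≡ b ℕ.+ k → ¬ Representable a b k) → n ∈ upTo b ++ B
    <b∨b+NR {n} h with n ℕ.<? b
    ... | yes n<b = ∈-++⁺ˡ (∈-upTo⁺ n<b)
    ... | no  n≮b with ℕ.m≤n⇒∃[o]m+o≡n (ℕ.≮⇒≥ n≮b)
    ...   | k , refl = ∈-++⁺ʳ (upTo b) (∈-map⁺ (b ℕ.+_) (∈NR⁺ (h refl)))

    to : ∀ {n} → n ∈ NR a b ++ A → n ∈ upTo b ++ B
    to n∈ with ∈-++⁻ (NR a b) n∈
    ... | inj₁ n∈NR = <b∨b+NR λ { refl → ∈NR⁻ n∈NR ∘ b+representable }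
    ... | inj₂ n∈A with ∈-map⁻ (a ℕ.*_) n∈A
    ...   | i , i∈ , refl = <b∨b+NR (ai≢b+representable (∈-upTo⁻ i∈))

    -- A representable n of this kind equals a x with x < b, because the representation found by
    -- `representable?` is forced to have y = 0.
    NR∨ai : ∀ {n} → (∀ x y → n ≡ a ℕ.* x ℕ.+ b ℕ.* y → y ≡ 0 × x ℕ.< b) → n ∈ NR a b ++ A
    NR∨ai {n} h with representable? a b n
    ... | no  ¬rep = ∈-++⁺ˡ (∈NR⁺ ¬rep)
    ... | yes (x , y , e) with h x y e
    ...   | refl , x<b = ∈-++⁺ʳ (NR a b) (subst (_∈ A)
              (sym (trans e (trans (cong (a ℕ.* x ℕ.+_) (ℕ.*-zeroʳ b)) (ℕ.+-identityʳ _))))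
              (∈-map⁺ (a ℕ.*_) (∈-upTo⁺ x<b)))

    <b : ∀ {n} → n ℕ.< b → ∀ x y → n ≡ a ℕ.* x ℕ.+ b ℕ.* y → y ≡ 0 × x ℕ.< b
    <b n<b x zero    refl = refl ,
      ℕ.≤-<-trans (ℕ.≤-trans (ℕ.m≤n*m x a) (ℕ.m≤m+n (a ℕ.* x) (b ℕ.* 0))) n<b
    <b n<b x (suc y) refl = ⊥-elim (ℕ.<-irrefl refl (ℕ.<-≤-trans n<b
      (ℕ.≤-trans (ℕ.m≤m*n b (suc y)) (ℕ.m≤n+m (b ℕ.* suc y) (a ℕ.* x)))))

    -- Any other representation of b + k would give one of k: if y > 0, lower y by one; if y = 0 and
    -- x = b + d, then a (b + d) = b + (a d + b (a - 1)), so k = a d + b (a - 1).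
    b+NR : ∀ {k} → ¬ Representable a b k → ∀ x y → b ℕ.+ k ≡ a ℕ.* x ℕ.+ b ℕ.* y → y ≡ 0 × x ℕ.< b
    b+NR {k} ¬rep x (suc y) e = ⊥-elim (¬rep (x , y , ℕ.+-cancelˡ-≡ b _ _ (trans e (sym (b+[ax+by] a b x y)))))
    b+NR {k} ¬rep x zero e with x ℕ.<? b
    ... | yes x<b = refl , x<b
    ... | no  x≮b with ℕ.m≤n⇒∃[o]m+o≡n (ℕ.≮⇒≥ x≮b)
    ...   | d , refl = ⊥-elim (¬rep (d , ℕ.pred a , ℕ.+-cancelˡ-≡ b _ _
              (trans e (trans (cong (λ a → a ℕ.* (b ℕ.+ d) ℕ.+ b ℕ.* 0) (sym (ℕ.suc-pred a)))
                (trans (regroup (ℕ.pred a) b d)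
                  (cong (λ a → b ℕ.+ (a ℕ.* d ℕ.+ b ℕ.* ℕ.pred a)) (ℕ.suc-pred a)))))))
      where
      regroup : ∀ a′ b d → suc a′ ℕ.* (b ℕ.+ d) ℕ.+ b ℕ.* 0 ≡ b ℕ.+ (suc a′ ℕ.* d ℕ.+ b ℕ.* a′)
      regroup = ℕ-solver.solve-∀

    from : ∀ {n} → n ∈ upTo b ++ B → n ∈ NR a b ++ A
    from n∈ with ∈-++⁻ (upTo b) n∈
    ... | inj₁ n∈upTo = NR∨ai (<b (∈-upTo⁻ n∈upTo))
    ... | inj₂ n∈B with ∈-map⁻ (b ℕ.+_) n∈B
    ...   | k , k∈NR , refl = NR∨ai (b+NR (∈NR⁻ k∈NR))

-- Sums over lists in a commutative ring

module ListSums {c ℓ} (R : CommutativeRing c ℓ) where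

  private module R = CommutativeRing R
  open R using (Carrier; _≈_; _+_; _*_; 0#)
  open SetoidReasoning R.setoid
  open RingSolver R.commutativeSemiring using (solve; _:=_; _:+_; _:*_)

  ∑ˡ : List ℕ → (ℕ → Carrier) → Carrier
  ∑ˡ ns f = foldr _+_ 0# (map f ns)

  ∑ˡ-cong : ∀ ns {f g : ℕ → Carrier} → (∀ n → f n ≈ g n) → ∑ˡ ns f ≈ ∑ˡ ns g
  ∑ˡ-cong []       f≈g = R.refl
  ∑ˡ-cong (n ∷ ns) f≈g = R.+-cong (f≈g n) (∑ˡ-cong ns f≈g)

  *-distribˡ-∑ˡ : ∀ x ns f → x * ∑ˡ ns f ≈ ∑ˡ ns (λ n → x * f n)
  *-distribˡ-∑ˡ x []       f = R.zeroʳ x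
  *-distribˡ-∑ˡ x (n ∷ ns) f = R.trans (R.distribˡ x (f n) (∑ˡ ns f)) (R.+-congˡ (*-distribˡ-∑ˡ x ns f))

  ∑ˡ-++ : ∀ ms ns f → ∑ˡ (ms ++ ns) f ≈ ∑ˡ ms f + ∑ˡ ns f
  ∑ˡ-++ []       ns f = R.sym (R.+-identityˡ (∑ˡ ns f))
  ∑ˡ-++ (m ∷ ms) ns f = R.trans (R.+-congˡ (∑ˡ-++ ms ns f)) (R.sym (R.+-assoc (f m) (∑ˡ ms f) (∑ˡ ns f)))

  ∑ˡ-map : ∀ (h : ℕ → ℕ) ns f → ∑ˡ (map h ns) f ≡ ∑ˡ ns (f ∘ h)
  ∑ˡ-map h ns f = cong (foldr _+_ 0#) (sym (List.map-∘ ns))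

  ∑ˡ-↭ : ∀ {ms ns} f → ms ↭ ns → ∑ˡ ms f ≈ ∑ˡ ns f
  ∑ˡ-↭ f Perm.refl         = R.refl
  ∑ˡ-↭ f (Perm.prep n p)   = R.+-congˡ (∑ˡ-↭ f p)
  ∑ˡ-↭ f (Perm.swap {xs} {ys} m n p) = R.trans
    (R.+-congˡ (R.+-congˡ (∑ˡ-↭ f p)))
    (solve 3 (λ x y s → x :+ (y :+ s) := y :+ (x :+ s)) R.refl (f m) (f n) (∑ˡ ys f))
  ∑ˡ-↭ f (Perm.trans p q)  = R.trans (∑ˡ-↭ f p) (∑ˡ-↭ f q)

  -- The sum of the differences f (i + 1) - f i, with the negative terms moved across.
  ∑ˡ-telescope : ∀ n f → ∑ˡ (upTo n) (f ∘ suc) + f 0 ≈ ∑ˡ (upTo n) f + f n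
  ∑ˡ-telescope zero    f = R.refl
  ∑ˡ-telescope (suc n) f = begin
    f 1 + ∑ˡ (applyUpTo suc n) (f ∘ suc) + f 0
      ≡⟨ cong (λ s → f 1 + s + f 0) (upTo-suc (f ∘ suc)) ⟩
    f 1 + ∑ˡ (upTo n) (λ i → f (suc (suc i))) + f 0
      ≈⟨ solve 3 (λ x s y → x :+ s :+ y := y :+ (s :+ x)) R.refl (f 1) _ (f 0) ⟩
    f 0 + (∑ˡ (upTo n) (λ i → f (suc (suc i))) + f 1)
      ≈⟨ R.+-congˡ (∑ˡ-telescope n (f ∘ suc)) ⟩
    f 0 + (∑ˡ (upTo n) (f ∘ suc) + f (suc n))
      ≈⟨ R.+-assoc (f 0) _ (f (suc n)) ⟨
    f 0 + ∑ˡ (upTo n) (f ∘ suc) + f (suc n)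
      ≡⟨ cong (λ s → f 0 + s + f (suc n)) (upTo-suc f) ⟨
    f 0 + ∑ˡ (applyUpTo suc n) f + f (suc n) ∎
    where
    upTo-suc : ∀ f → ∑ˡ (applyUpTo suc n) f ≡ ∑ˡ (upTo n) (f ∘ suc)
    upTo-suc f = cong (foldr _+_ 0#) (trans (List.map-applyUpTo suc f n) (sym (List.map-upTo (f ∘ suc) n)))

  module _ (T : ℕ → Carrier) (T-homo : ∀ m n → T (m ℕ.+ n) ≈ T m * T n) where

    -- `T 0` stands where 1 is expected: in a general ring, multiplicativity of `T` only makes it
    -- idempotent.
    geometric : ∀ c n → let Γ = ∑ˡ (upTo n) (λ i → T (c ℕ.* i)) in T c * Γ + T 0 ≈ Γ + T (c ℕ.* n)
    geometric c n = begin
      T c * Γ + T 0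
        ≈⟨ R.+-cong (*-distribˡ-∑ˡ (T c) (upTo n) (T ∘ (c ℕ.*_))) (R.reflexive (cong T (sym (ℕ.*-zeroʳ c)))) ⟩
      ∑ˡ (upTo n) (λ i → T c * T (c ℕ.* i)) + T (c ℕ.* 0)
        ≈⟨ R.+-congʳ (∑ˡ-cong (upTo n) λ i →
             R.trans (R.sym (T-homo c (c ℕ.* i))) (R.reflexive (cong T (sym (ℕ.*-suc c i))))) ⟩
      ∑ˡ (upTo n) (λ i → T (c ℕ.* suc i)) + T (c ℕ.* 0)
        ≈⟨ ∑ˡ-telescope n (T ∘ (c ℕ.*_)) ⟩
      Γ + T (c ℕ.* n) ∎
      where Γ = ∑ˡ (upTo n) (T ∘ (c ℕ.*_))

    -- `NR-shift` summed through `T`: the shift by b becomes the factor `T b`, so G is pinned down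
    -- by (T b - 1) G.
    ∑ˡ-NR : ∀ a b .{{_ : NonZero a}} .{{_ : NonZero b}} → gcd a b ≡ 1 →
      ∑ˡ (Defs.NR a b) T + ∑ˡ (upTo b) (λ i → T (a ℕ.* i)) ≈ ∑ˡ (upTo b) T + T b * ∑ˡ (Defs.NR a b) T
    ∑ˡ-NR a b coprime = begin
      ∑ˡ NR T + ∑ˡ (upTo b) (T ∘ (a ℕ.*_))        ≡⟨ cong (λ s → ∑ˡ NR T + s) (∑ˡ-map (a ℕ.*_) (upTo b) T) ⟨
      ∑ˡ NR T + ∑ˡ (map (a ℕ.*_) (upTo b)) T      ≈⟨ ∑ˡ-++ NR _ T ⟨
      ∑ˡ (NR ++ map (a ℕ.*_) (upTo b)) T          ≈⟨ ∑ˡ-↭ T (NR-shift a b coprime) ⟩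
      ∑ˡ (upTo b ++ map (b ℕ.+_) NR) T            ≈⟨ ∑ˡ-++ (upTo b) _ T ⟩
      ∑ˡ (upTo b) T + ∑ˡ (map (b ℕ.+_) NR) T      ≡⟨ cong (λ s → ∑ˡ (upTo b) T + s) (∑ˡ-map (b ℕ.+_) NR T) ⟩
      ∑ˡ (upTo b) T + ∑ˡ NR (λ n → T (b ℕ.+ n))   ≈⟨ R.+-congˡ (∑ˡ-cong NR (T-homo b)) ⟩
      ∑ˡ (upTo b) T + ∑ˡ NR (λ n → T b * T n)     ≈⟨ R.+-congˡ (*-distribˡ-∑ˡ (T b) NR T) ⟨
      ∑ˡ (upTo b) T + T b * ∑ˡ NR T               ∎
      where NR = Defs.NR a b

  -- Both hypotheses are stated without subtraction: (t - 1) u ≈ z and (t - 1) x ≈ w - y.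
  module _ (t : Carrier) {u z : Carrier} (tu≈z+u : t * u ≈ z + u) where

    private

      t*ux : ∀ x → u * (t * x) ≈ z * x + u * x
      t*ux x = begin
        u * (t * x)    ≈⟨ solve 3 (λ u t x → u :* (t :* x) := t :* u :* x) R.refl u t x ⟩
        t * u * x      ≈⟨ R.*-congʳ tu≈z+u ⟩
        (z + u) * x    ≈⟨ R.distribʳ x z u ⟩
        z * x + u * x  ∎

    clear-denominator : ∀ {x y w} → t * x + y ≈ x + w → z * x + u * y ≈ u * w
    -- Both sides are compared after adding `u * x`, and cancelling it uses only the additive group;
    -- neither t - 1 nor u has to be invertible.
    clear-denominator {x} {y} {w} tx+y≈x+w = cancelˡ (u * x) _ _ (begin
      u * x + (z * x + u * y)  ≈⟨ solve 3 (λ p q r → p :+ (q :+ r) := (q :+ p) :+ r) R.refl (u * x) (z * x) (u * y) ⟩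
      z * x + u * x + u * y    ≈⟨ R.+-congʳ (t*ux x) ⟨
      u * (t * x) + u * y      ≈⟨ R.distribˡ u (t * x) y ⟨
      u * (t * x + y)          ≈⟨ R.*-congˡ tx+y≈x+w ⟩
      u * (x + w)              ≈⟨ R.distribˡ u x w ⟩
      u * x + u * w            ∎)
      where open AbelianGroupProperties R.+-abelianGroup using () renaming (∙-cancelˡ to cancelˡ)

-- The integer exponents of the formula

exponent-a : ∀ {m ℓ} i → ℓ ℕ.≤ m → + m ℤ.- + ℓ ℤ.+ + i ℤ.- 1ℤ ≡ + (m ∸ ℓ ℕ.+ i) ℤ.- 1ℤ
exponent-a {m} {ℓ} i ℓ≤m = cong (λ k → k ℤ.+ + i ℤ.- 1ℤ) (trans (ℤ.m-n≡m⊖n m ℓ) (ℤ.⊖-≥ ℓ≤m))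

-- With k = m + 2 - i a natural number, the exponent never falls below -1. A natural number minus 1
-- is the form that `^ᶻ-pred` turns into an inverse times an ordinary power.
exponent-b : ∀ m i k → k ℕ.+ i ≡ m ℕ.+ 2 → + m ℤ.- + i ℤ.+ 1ℤ ≡ + k ℤ.- 1ℤ
exponent-b m i k k+i≡m+2 = begin
  + m ℤ.- + i ℤ.+ 1ℤ            ≡⟨ add (+ m) (+ i) ⟩
  + (m ℕ.+ 2) ℤ.- + i ℤ.- 1ℤ    ≡⟨ cong (λ n → + n ℤ.- + i ℤ.- 1ℤ) k+i≡m+2 ⟨
  + (k ℕ.+ i) ℤ.- + i ℤ.- 1ℤ    ≡⟨ cancel (+ k) (+ i) ⟩
  + k ℤ.- 1ℤ                    ∎
  where
  open ≡-Reasoning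
  add : ∀ m i → m ℤ.- i ℤ.+ 1ℤ ≡ m ℤ.+ + 2 ℤ.- i ℤ.- 1ℤ
  add = ℤ-solver.solve-∀
  cancel : ∀ k i → k ℤ.+ i ℤ.- i ℤ.- 1ℤ ≡ k ℤ.- 1ℤ
  cancel = ℤ-solver.solve-∀

-- The ring of formal power series

module Series {c ℓ₁ ℓ₂} (K : HeytingField c ℓ₁ ℓ₂) (char0 : Defs.CharacteristicZero K) where

  open Defs.ApostolBernoulli K char0

  field-commutativeRing : CommutativeRing c ℓ₁
  field-commutativeRing = HeytingCommutativeRing.commutativeRing (HeytingField.heytingCommutativeRing K)

  private module K = CommutativeRing field-commutativeRing

  open SetoidReasoning K.setoid
  open RingSolver K.commutativeSemiring using (solve; con; _:=_; _:+_; _:*_)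
  open Sum K.semiring using (sum-cong-≋; *-distribˡ-sum; ∑-distrib-+)

  ∑≤-cong : ∀ n {f g : ℕ → Carrier} → (∀ i → i ℕ.≤ n → f i ≈ g i) → ∑≤ n f ≈ ∑≤ n g
  ∑≤-cong n f≈g = sum-cong-≋ {suc n} λ k → f≈g (toℕ k) (ℕ.s≤s⁻¹ (Fin.toℕ<n k))

  *-distribˡ-∑≤ : ∀ n x f → x * ∑≤ n f ≈ ∑[ i ≤ n ] (x * f i)
  *-distribˡ-∑≤ n x f = *-distribˡ-sum x (λ (k : Fin (suc n)) → f (toℕ k))

  infix 4 _≋_

  _≋_ : PowerSeries → PowerSeries → Set ℓ₁
  f ≋ g = ∀ n → f n ≈ g n

  shift : PowerSeries → PowerSeries
  shift f n = f (suc n)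

  ⊛-cong : ∀ {f f′ g g′} → f ≋ f′ → g ≋ g′ → f ⊛ g ≋ f′ ⊛ g′
  ⊛-cong f≋f′ g≋g′ n = ∑≤-cong n λ k _ → K.*-cong (f≋f′ k) (g≋g′ (n ∸ k))

  -- A product unfolds by definition at the head of its left factor: f 0 g (n + 1) + (shift f ⊛ g)
  -- n. This is the mirror rule, and the two together give commutativity by induction.
  ⊛-shiftʳ : ∀ f g n → (f ⊛ g) (suc n) ≈ (f ⊛ shift g) n + f (suc n) * g 0
  ⊛-shiftʳ f g zero    = K.trans
    (K.+-congˡ (K.+-identityʳ (f 1 * g 0)))
    (K.+-congʳ (K.sym (K.+-identityʳ (f 0 * g 1))))
  ⊛-shiftʳ f g (suc n) = K.trans
    (K.+-congˡ (⊛-shiftʳ (shift f) g n))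
    (K.sym (K.+-assoc (f 0 * g (suc (suc n))) _ _))

  ⊛-comm : ∀ f g → f ⊛ g ≋ g ⊛ f
  ⊛-comm f g zero    = K.+-congʳ (K.*-comm (f 0) (g 0))
  ⊛-comm f g (suc n) = begin
    f 0 * g (suc n) + (shift f ⊛ g) n    ≈⟨ K.+-cong (K.*-comm (f 0) (g (suc n))) (⊛-comm (shift f) g n) ⟩
    g (suc n) * f 0 + (g ⊛ shift f) n    ≈⟨ K.+-comm _ _ ⟩
    (g ⊛ shift f) n + g (suc n) * f 0    ≈⟨ ⊛-shiftʳ g f n ⟨
    (g ⊛ f) (suc n)                      ∎

  ⊛-distribʳ : ∀ h f g → (λ n → f n + g n) ⊛ h ≋ (λ n → (f ⊛ h) n + (g ⊛ h) n)
  ⊛-distribʳ h f g n = K.trans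
    (∑≤-cong n λ k _ → K.distribʳ (h (n ∸ k)) (f k) (g k))
    (∑-distrib-+ (λ (k : Fin (suc n)) → f (toℕ k) * h (n ∸ toℕ k)) (λ k → g (toℕ k) * h (n ∸ toℕ k)))

  ⊛-scaleˡ : ∀ x f g n → ((λ n → x * f n) ⊛ g) n ≈ x * (f ⊛ g) n
  ⊛-scaleˡ x f g n = K.trans
    (∑≤-cong n λ k _ → K.*-assoc x (f k) (g (n ∸ k)))
    (K.sym (*-distribˡ-∑≤ n x (λ k → f k * g (n ∸ k))))

  -- Induction on the index, using that `shift (f ⊛ g)` is by definition f 0 · shift g + shift f ⊛
  -- g.
  ⊛-assoc : ∀ f g h → (f ⊛ g) ⊛ h ≋ f ⊛ (g ⊛ h)
  ⊛-assoc f g h zero = solve 3 (λ x y z → (x :* y :+ con 0) :* z :+ con 0 := x :* (y :* z :+ con 0) :+ con 0)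
    K.refl (f 0) (g 0) (h 0)
  ⊛-assoc f g h (suc n) = begin
    (f ⊛ g) 0 * h (suc n) + (shift (f ⊛ g) ⊛ h) n
      ≈⟨ K.+-cong (K.*-congʳ (K.+-identityʳ (f 0 * g 0))) (⊛-distribʳ h (λ k → f 0 * shift g k) (shift f ⊛ g) n) ⟩
    f 0 * g 0 * h (suc n) + (((λ k → f 0 * shift g k) ⊛ h) n + ((shift f ⊛ g) ⊛ h) n)
      ≈⟨ K.+-congˡ (K.+-cong (⊛-scaleˡ (f 0) (shift g) h n) (⊛-assoc (shift f) g h n)) ⟩
    f 0 * g 0 * h (suc n) + (f 0 * (shift g ⊛ h) n + (shift f ⊛ (g ⊛ h)) n)
      ≈⟨ solve 5 (λ x y z u v → x :* y :* z :+ (x :* u :+ v) := x :* (y :* z :+ u) :+ v)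
           K.refl (f 0) (g 0) (h (suc n)) _ _ ⟩
    f 0 * (g ⊛ h) (suc n) + (shift f ⊛ (g ⊛ h)) n ∎

  ⊛-zeroˡ : ∀ {f} g n → (∀ k → k ℕ.≤ n → f k ≈ 0#) → (f ⊛ g) n ≈ 0#
  ⊛-zeroˡ g zero    f≈0 = K.trans (K.+-identityʳ _) (K.trans (K.*-congʳ (f≈0 0 ℕ.z≤n)) (K.zeroˡ (g 0)))
  ⊛-zeroˡ {f} g (suc n) f≈0 = K.trans
    (K.+-cong (K.trans (K.*-congʳ (f≈0 0 ℕ.z≤n)) (K.zeroˡ (g (suc n))))
              (⊛-zeroˡ g n λ k k≤n → f≈0 (suc k) (ℕ.s≤s k≤n)))
    (K.+-identityʳ 0#)

  ⊛-identityˡ : ∀ f → 1ˢ ⊛ f ≋ f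
  ⊛-identityˡ f zero    = K.trans (K.+-identityʳ _) (K.*-identityˡ (f 0))
  ⊛-identityˡ f (suc n) = K.trans
    (K.+-cong (K.*-identityˡ (f (suc n))) (⊛-zeroˡ {shift 1ˢ} f n λ _ _ → K.refl)) (K.+-identityʳ (f (suc n)))

  series-commutativeRing : CommutativeRing c ℓ₁
  series-commutativeRing = record
    { Carrier = PowerSeries
    ; _≈_ = _≋_
    ; _+_ = λ f g n → f n + g n
    ; _*_ = _⊛_
    ; -_ = λ f n → - f n
    ; 0# = λ _ → 0#
    ; 1# = 1ˢ
    ; isCommutativeRing = record
      { isRing = record
        { +-isAbelianGroup = Pointwise.isAbelianGroup ℕ K.+-isAbelianGroup
        ; *-cong = ⊛-cong
        ; *-assoc = ⊛-assoc
        ; *-identity = ⊛-identityˡ , λ f n → K.trans (⊛-comm f 1ˢ n) (⊛-identityˡ f n)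
        ; distrib = (λ f g h n → K.trans (⊛-comm f (λ n → g n + h n) n)
                      (K.trans (⊛-distribʳ f g h n) (K.+-cong (⊛-comm g f n) (⊛-comm h f n))))
                  , ⊛-distribʳ
        }
      ; *-comm = ⊛-comm
      }
    }

  -- f (x z) for the series f (z).
  dilate : Carrier → PowerSeries → PowerSeries
  dilate x f n = x ^ n * f n

  open Exp K.commutativeSemiring using (^-homo-*; ^-distrib-*; ^-congˡ)

  dilate-⊛ : ∀ x f g → dilate x (f ⊛ g) ≋ dilate x f ⊛ dilate x g
  dilate-⊛ x f g n = K.trans (*-distribˡ-∑≤ n (x ^ n) (λ k → f k * g (n ∸ k))) (∑≤-cong n λ k k≤n → begin
    x ^ n * (f k * g (n ∸ k))                    ≡⟨ cong (λ m → x ^ m * (f k * g (n ∸ k))) (ℕ.m+[n∸m]≡n k≤n) ⟨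
    x ^ (k ℕ.+ (n ∸ k)) * (f k * g (n ∸ k))      ≈⟨ K.*-congʳ (^-homo-* x k (n ∸ k)) ⟩
    x ^ k * x ^ (n ∸ k) * (f k * g (n ∸ k))
      ≈⟨ solve 4 (λ p q r s → p :* q :* (r :* s) := p :* r :* (q :* s)) K.refl (x ^ k) _ (f k) _ ⟩
    x ^ k * f k * (x ^ (n ∸ k) * g (n ∸ k))      ∎)

  -- `dilate x zˢ` is the series x z. Reading a product one coefficient higher is how a factor z is
  -- cancelled later.
  dilate-z-⊛ : ∀ x f n → (dilate x zˢ ⊛ f) (suc n) ≈ x * f n
  dilate-z-⊛ x f n = begin
    x ^ 0 * 0# * f (suc n) + (shift (dilate x zˢ) ⊛ f) n
      ≈⟨ K.+-cong (K.trans (K.*-congʳ (K.zeroʳ (x ^ 0))) (K.zeroˡ (f (suc n))))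
           (⊛-cong {g = f} dilate-z (λ _ → K.refl) n) ⟩
    0# + ((λ k → x * 1ˢ k) ⊛ f) n    ≈⟨ K.+-identityˡ _ ⟩
    ((λ k → x * 1ˢ k) ⊛ f) n         ≈⟨ ⊛-scaleˡ x 1ˢ f n ⟩
    x * (1ˢ ⊛ f) n                   ≈⟨ K.*-congˡ (⊛-identityˡ f n) ⟩
    x * f n                          ∎
    where
    dilate-z : shift (dilate x zˢ) ≋ (λ k → x * 1ˢ k)
    dilate-z zero    = K.*-congʳ (K.*-identityʳ x)
    dilate-z (suc k) = K.trans (K.zeroʳ _) (K.sym (K.zeroʳ x))

  -- Inverses, factorials and binomial coefficients in the field

  open Mult K.semiring using () renaming
    (_×_ to _·_; ×-congʳ to ·-congʳ; ×-assoc-* to ·-assoc-*; ×-homo-+ to ·-homo-+; ×1-homo-* to ·1-homo-*)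

  fromℕ-+ : ∀ m n → fromℕ (m ℕ.+ n) ≈ fromℕ m + fromℕ n
  fromℕ-+ = ·-homo-+ 1#

  fromℕ-* : ∀ m n → fromℕ (m ℕ.* n) ≈ fromℕ m * fromℕ n
  fromℕ-* = ·1-homo-*

  fromℕ-1 : fromℕ 1 ≈ 1#
  fromℕ-1 = K.+-identityʳ 1#

  -- The inverse is extracted from a proof of apartness, so it has no formula of its own; uniqueness
  -- is what allows computing with it.
  ⁻¹-unique : ∀ x {y} → proj₁ x * y ≈ 1# → x ⁻¹ ≈ y
  ⁻¹-unique x {y} xy≈1 = begin
    x ⁻¹                   ≈⟨ K.*-identityʳ (x ⁻¹) ⟨
    x ⁻¹ * 1#              ≈⟨ K.*-congˡ xy≈1 ⟨
    x ⁻¹ * (proj₁ x * y)   ≈⟨ solve 3 (λ x y z → x :* (y :* z) := y :* x :* z) K.refl (x ⁻¹) (proj₁ x) y ⟩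
    proj₁ x * x ⁻¹ * y     ≈⟨ K.*-congʳ (*-inverseʳ x) ⟩
    1# * y                 ≈⟨ K.*-identityˡ y ⟩
    y                      ∎

  ·ˣ-⁻¹ : ∀ x y → (x ·ˣ y) ⁻¹ ≈ x ⁻¹ * y ⁻¹
  ·ˣ-⁻¹ x y = ⁻¹-unique (x ·ˣ y) (begin
    proj₁ x * proj₁ y * (x ⁻¹ * y ⁻¹)
      ≈⟨ solve 4 (λ x y z w → x :* y :* (z :* w) := x :* z :* (y :* w)) K.refl (proj₁ x) (proj₁ y) _ _ ⟩
    proj₁ x * x ⁻¹ * (proj₁ y * y ⁻¹)  ≈⟨ K.*-cong (*-inverseʳ x) (*-inverseʳ y) ⟩
    1# * 1#                            ≈⟨ K.*-identityˡ 1# ⟩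
    1#                                 ∎)

  private

    nCk*[k!*[n∸k]!]≡n! : ∀ {n k} → k ℕ.≤ n → (n C k) ℕ.* (k ! ℕ.* (n ∸ k) !) ≡ n !
    nCk*[k!*[n∸k]!]≡n! {n} {k} k≤n = trans
      (cong (ℕ._* (k ! ℕ.* (n ∸ k) !)) (ℕ.nCk≡n!/k![n-k]! k≤n))
      (ℕ.m/n*n≡m {{k ℕ.!* (n ∸ k) !≢0}} (ℕ.k![n∸k]!∣n! k≤n))

  fromℕ-C : ∀ {n k} → k ℕ.≤ n → fromℕ (n C k) ≈ fromℕ (n !) * (k !ˣ ⁻¹ * (n ∸ k) !ˣ ⁻¹)
  fromℕ-C {n} {k} k≤n = begin
    nCk                                ≈⟨ K.*-identityʳ nCk ⟨
    nCk * 1#                           ≈⟨ K.*-congˡ (K.*-identityˡ 1#) ⟨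
    nCk * (1# * 1#)                    ≈⟨ K.*-congˡ (K.*-cong (*-inverseʳ (k !ˣ)) (*-inverseʳ ((n ∸ k) !ˣ))) ⟨
    nCk * (x * x⁻¹ * (y * y⁻¹))
      ≈⟨ solve 5 (λ nCk x x⁻¹ y y⁻¹ → nCk :* (x :* x⁻¹ :* (y :* y⁻¹)) := nCk :* (x :* y) :* (x⁻¹ :* y⁻¹))
           K.refl nCk x x⁻¹ y y⁻¹ ⟩
    nCk * (x * y) * (x⁻¹ * y⁻¹)        ≈⟨ K.*-congʳ nCk*xy≈n! ⟩
    fromℕ (n !) * (x⁻¹ * y⁻¹)        ∎
    where
    nCk   = fromℕ (n C k)
    x   = fromℕ (k !)
    y   = fromℕ ((n ∸ k) !)
    x⁻¹ = k !ˣ ⁻¹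
    y⁻¹ = (n ∸ k) !ˣ ⁻¹

    nCk*xy≈n! : nCk * (x * y) ≈ fromℕ (n !)
    nCk*xy≈n! = begin
      nCk * (x * y)                            ≈⟨ K.*-congˡ (fromℕ-* (k !) ((n ∸ k) !)) ⟨
      nCk * fromℕ (k ! ℕ.* (n ∸ k) !)          ≈⟨ fromℕ-* (n C k) (k ! ℕ.* (n ∸ k) !) ⟨
      fromℕ ((n C k) ℕ.* (k ! ℕ.* (n ∸ k) !))  ≡⟨ cong fromℕ (nCk*[k!*[n∸k]!]≡n! k≤n) ⟩
      fromℕ (n !)                            ∎

  -- Powers of ƛ eᶻ and the Apostol-Bernoulli series

  module P = CommutativeRing series-commutativeRing
  module ∑ˢ = ListSums series-commutativeRing
  open ∑ˢ using (∑ˡ)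

  -- The series (ƛ eᶻ)ⁿ.
  powers : Carrier → ℕ → PowerSeries
  powers ƛ n k = ƛ ^ n * (fromℕ n ^ k / k !ˣ)

  -- The addition law of exp is the binomial theorem coefficient by coefficient: the k! of `k C j`
  -- cancels 1/k!, and its other two factorials go to the two factors.
  powers-+ : ∀ ƛ m n → powers ƛ (m ℕ.+ n) ≋ powers ƛ m ⊛ powers ƛ n
  powers-+ ƛ m n k = begin
    ƛ ^ (m ℕ.+ n) * (fromℕ (m ℕ.+ n) ^ k * k!⁻¹)
      ≈⟨ K.*-cong (^-homo-* ƛ m n) (K.*-congʳ (K.trans (^-congˡ k (fromℕ-+ m n))
           (Binomial.theorem K.commutativeSemiring k (fromℕ m) (fromℕ n)))) ⟩
    ƛ ^ m * ƛ ^ n * (∑≤ k expansion * k!⁻¹)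
      ≈⟨ solve 4 (λ x y s z → x :* y :* (s :* z) := x :* y :* z :* s) K.refl (ƛ ^ m) (ƛ ^ n) _ k!⁻¹ ⟩
    ƛ ^ m * ƛ ^ n * k!⁻¹ * ∑≤ k expansion
      ≈⟨ *-distribˡ-∑≤ k (ƛ ^ m * ƛ ^ n * k!⁻¹) expansion ⟩
    ∑≤ k (λ j → ƛ ^ m * ƛ ^ n * k!⁻¹ * expansion j)
      ≈⟨ ∑≤-cong k summand ⟩
    (powers ƛ m ⊛ powers ƛ n) k ∎
    where
    k!⁻¹ = k !ˣ ⁻¹

    monomial expansion : ℕ → Carrier
    monomial j  = fromℕ m ^ j * fromℕ n ^ (k ∸ j)
    expansion j = (k C j) · monomial j

    summand : ∀ j → j ℕ.≤ k →
      ƛ ^ m * ƛ ^ n * k!⁻¹ * expansion j ≈ powers ƛ m j * powers ƛ n (k ∸ j)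
    summand j j≤k = begin
      ƛ ^ m * ƛ ^ n * k!⁻¹ * expansion j
        ≈⟨ K.*-congˡ (K.trans (·-congʳ (k C j) (K.sym (K.*-identityˡ (monomial j))))
             (K.sym (·-assoc-* (k C j) 1# (monomial j)))) ⟩
      ƛ ^ m * ƛ ^ n * k!⁻¹ * (fromℕ (k C j) * monomial j)
        ≈⟨ K.*-congˡ (K.*-congʳ (fromℕ-C j≤k)) ⟩
      ƛ ^ m * ƛ ^ n * k!⁻¹ * (fromℕ (k !) * (j !ˣ ⁻¹ * (k ∸ j) !ˣ ⁻¹) * monomial j)
        ≈⟨ solve 8 (λ x y z w u v s t → x :* y :* z :* (w :* (u :* v) :* (s :* t))
             := w :* z :* (x :* (s :* u) :* (y :* (t :* v))))
             K.refl (ƛ ^ m) (ƛ ^ n) k!⁻¹ (fromℕ (k !)) (j !ˣ ⁻¹) ((k ∸ j) !ˣ ⁻¹) (fromℕ m ^ j) (fromℕ n ^ (k ∸ j)) ⟩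
      fromℕ (k !) * k!⁻¹ * (powers ƛ m j * powers ƛ n (k ∸ j))
        ≈⟨ K.trans (K.*-congʳ (*-inverseʳ (k !ˣ))) (K.*-identityˡ _) ⟩
      powers ƛ m j * powers ƛ n (k ∸ j) ∎

  powers-0 : ∀ ƛ → powers ƛ 0 ≋ 1ˢ
  powers-0 ƛ zero    = K.trans (K.*-identityˡ _) (K.trans (K.*-identityˡ _)
    (⁻¹-unique (0 !ˣ) (K.trans (K.*-identityʳ (fromℕ 1)) fromℕ-1)))
  powers-0 ƛ (suc k) = K.trans (K.*-identityˡ _) (K.trans (K.*-congʳ (K.zeroˡ (0# ^ k))) (K.zeroˡ _))

  bernoulli : ∀ μ → μ # 1# → PowerSeries
  bernoulli μ μ#1 k = 𝓑 k μ μ#1 / k !ˣ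

  -- `𝓑-generating` with z replaced by n z, that is (xⁿ - 1) β_n = n z with the 1 moved across.
  -- Requiring μ only up to `≈` lets the case n = 1 use ƛ in place of `ƛ ^ 1`.
  powers-bernoulli : ∀ {ƛ μ} n (μ#1 : μ # 1#) → μ ≈ ƛ ^ n →
    let β = dilate (fromℕ n) (bernoulli μ μ#1) in
    powers ƛ n ⊛ β ≋ (λ k → dilate (fromℕ n) zˢ k + β k)
  powers-bernoulli {ƛ} {μ} n μ#1 μ≈ƛⁿ k = begin
    (powers ƛ n ⊛ β) k
      ≈⟨ ⊛-cong {g = β} powers≋ (λ _ → K.refl) k ⟩
    ((λ j → dilate N D j + 1ˢ j) ⊛ β) k
      ≈⟨ ⊛-distribʳ β (dilate N D) 1ˢ k ⟩
    (dilate N D ⊛ β) k + (1ˢ ⊛ β) k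
      ≈⟨ K.+-cong (K.sym (dilate-⊛ N D (bernoulli μ μ#1) k)) (⊛-identityˡ β k) ⟩
    dilate N (D ⊛ bernoulli μ μ#1) k + β k
      ≈⟨ K.+-congʳ (K.*-congˡ (𝓑-generating μ μ#1 k)) ⟩
    dilate N zˢ k + β k ∎
    where
    N = fromℕ n
    β = dilate N (bernoulli μ μ#1)
    D = denominator μ

    dilate-1 : 1ˢ ≋ dilate N 1ˢ
    dilate-1 zero    = K.sym (K.*-identityˡ 1#)
    dilate-1 (suc j) = K.sym (K.zeroʳ (N ^ suc j))

    powers≋ : powers ƛ n ≋ (λ j → dilate N D j + 1ˢ j)
    powers≋ j = begin
      ƛ ^ n * (N ^ j * expˢ j)                        ≈⟨ K.*-congʳ μ≈ƛⁿ ⟨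
      μ * (N ^ j * expˢ j)
        ≈⟨ solve 3 (λ x y z → x :* (y :* z) := y :* (x :* z)) K.refl μ (N ^ j) (expˢ j) ⟩
      N ^ j * (μ * expˢ j)                            ≈⟨ K.*-congˡ (K.+-identityʳ (μ * expˢ j)) ⟨
      N ^ j * (μ * expˢ j + 0#)                       ≈⟨ K.*-congˡ (K.+-congˡ (K.-‿inverseˡ (1ˢ j))) ⟨
      N ^ j * (μ * expˢ j + (- 1ˢ j + 1ˢ j))          ≈⟨ K.*-congˡ (K.+-assoc (μ * expˢ j) (- 1ˢ j) (1ˢ j)) ⟨
      N ^ j * (D j + 1ˢ j)                            ≈⟨ K.distribˡ (N ^ j) (D j) (1ˢ j) ⟩
      dilate N D j + N ^ j * 1ˢ j                     ≈⟨ K.+-congˡ (dilate-1 j) ⟨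
      dilate N D j + 1ˢ j                             ∎

  -- The numerator z has no constant term and μ eᶻ - 1 has an invertible one. This makes β_a β_b
  -- start at z².
  bernoulli-0 : ∀ μ (μ#1 : μ # 1#) → bernoulli μ μ#1 0 ≈ 0#
  bernoulli-0 μ μ#1 = begin
    β₀                   ≈⟨ K.*-identityˡ β₀ ⟨
    1# * β₀              ≈⟨ K.*-congʳ (K.trans (K.*-comm D₀⁻¹ D₀) (*-inverseʳ (D₀ , denominator₀#0 μ#1))) ⟨
    D₀⁻¹ * D₀ * β₀       ≈⟨ K.*-assoc D₀⁻¹ D₀ β₀ ⟩
    D₀⁻¹ * (D₀ * β₀)     ≈⟨ K.*-congˡ (K.trans (K.sym (K.+-identityʳ _)) (𝓑-generating μ μ#1 0)) ⟩
    D₀⁻¹ * 0#            ≈⟨ K.zeroʳ D₀⁻¹ ⟩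
    0#                   ∎
    where
    β₀   = bernoulli μ μ#1 0
    D₀   = denominator μ 0
    D₀⁻¹ = (D₀ , denominator₀#0 μ#1) ⁻¹

  -- The generating-function identity

  module _ (a b : ℕ) .{{_ : NonZero a}} .{{_ : NonZero b}} (coprime : gcd a b ≡ 1)
    {ƛ : Carrier} (ƛ#1 : ƛ # 1#) (ƛᵃ#1 : ƛ ^ a # 1#) (ƛᵇ#1 : ƛ ^ b # 1#) where

    private

      A = fromℕ a
      B = fromℕ b
      T = powers ƛ
      -- `α`, `γ` and `δ` are β_a, β_b and β_1; the trivial dilation in `δ` gives it the shape that
      -- `powers-bernoulli` expects.
      α = dilate A (bernoulli (ƛ ^ a) ƛᵃ#1)
      γ = dilate B (bernoulli (ƛ ^ b) ƛᵇ#1)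
      δ = dilate (fromℕ 1) (bernoulli ƛ ƛ#1)
      G  = ∑ˡ (Defs.NR a b) T
      Γ  = ∑ˡ (upTo b) T
      Γᵃ = ∑ˡ (upTo b) (λ i → T (a ℕ.* i))

      Tᵇγ : T b ⊛ γ ≋ (λ k → dilate B zˢ k + γ k)
      Tᵇγ = powers-bernoulli b ƛᵇ#1 K.refl

      -- Clearing xᵇ - 1 from the residue-class identity gives β_b Γᵃ = b z G + β_b Γ, and β_b Γ = b
      -- β_1.
      γΓᵃ : ∀ n → (γ ⊛ Γᵃ) (suc n) ≈ B * (G n + δ (suc n))
      γΓᵃ n = begin
        (γ ⊛ Γᵃ) (suc n)
          ≈⟨ ∑ˢ.clear-denominator (T b) Tᵇγ
               (P.trans (P.+-comm (T b ⊛ G) Γ) (P.sym (∑ˢ.∑ˡ-NR T (powers-+ ƛ) a b coprime))) (suc n) ⟨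
        (dilate B zˢ ⊛ G) (suc n) + (γ ⊛ Γ) (suc n)
          ≈⟨ K.+-cong (dilate-z-⊛ B G n) (γΓ (suc n)) ⟩
        B * G n + B * δ (suc n)
          ≈⟨ K.distribˡ B (G n) (δ (suc n)) ⟨
        B * (G n + δ (suc n)) ∎
        where
        Γ¹ = ∑ˡ (upTo b) (λ i → T (1 ℕ.* i))

        TΓ : T 1 ⊛ Γ P.+ 1ˢ P.≈ Γ P.+ T b
        TΓ = P.trans
          (P.+-cong
            (⊛-cong {T 1} (λ _ → K.refl) (∑ˢ.∑ˡ-cong (upTo b) λ i → P.reflexive (cong T (sym (ℕ.*-identityˡ i)))))
            (P.sym (powers-0 ƛ)))
          (P.trans (∑ˢ.geometric T (powers-+ ƛ) 1 b)
            (P.+-cong (∑ˢ.∑ˡ-cong (upTo b) λ i → P.reflexive (cong T (ℕ.*-identityˡ i)))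
              (P.reflexive (cong T (ℕ.*-identityˡ b)))))

        zΓ+δ : dilate (fromℕ 1) zˢ ⊛ Γ P.+ δ ⊛ 1ˢ P.≈ δ ⊛ T b
        zΓ+δ = ∑ˢ.clear-denominator (T 1) (powers-bernoulli 1 ƛ#1 (K.sym (K.*-identityʳ ƛ))) TΓ

        -- `zΓ+δ` says (xᵇ - 1) β_1 = z Γ, so `clear-denominator` applies with 0 in the place of y.
        zδ : dilate B zˢ ⊛ δ P.+ γ ⊛ P.0# P.≈ γ ⊛ (dilate (fromℕ 1) zˢ ⊛ Γ)
        zδ = ∑ˢ.clear-denominator (T b) Tᵇγ
          (P.trans (P.+-identityʳ (T b ⊛ δ)) (P.trans (⊛-comm (T b) δ) (P.trans (P.sym zΓ+δ)
          (P.trans (P.+-comm (dilate (fromℕ 1) zˢ ⊛ Γ) (δ ⊛ 1ˢ)) (P.+-congʳ (P.*-identityʳ δ))))))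

        -- Formally (b z / (xᵇ - 1)) · ((xᵇ - 1) / (x - 1)). Both sides are compared after
        -- multiplication by z, one coefficient higher.
        γΓ : ∀ n → (γ ⊛ Γ) n ≈ B * δ n
        γΓ n = begin
          (γ ⊛ Γ) n                                      ≈⟨ K.*-identityˡ _ ⟨
          1# * (γ ⊛ Γ) n                                 ≈⟨ K.*-congʳ fromℕ-1 ⟨
          fromℕ 1 * (γ ⊛ Γ) n                            ≈⟨ dilate-z-⊛ (fromℕ 1) (γ ⊛ Γ) n ⟨
          (dilate (fromℕ 1) zˢ ⊛ (γ ⊛ Γ)) (suc n)        ≈⟨ x∙yz≈y∙xz (dilate (fromℕ 1) zˢ) γ Γ (suc n) ⟩
          (γ ⊛ (dilate (fromℕ 1) zˢ ⊛ Γ)) (suc n)        ≈⟨ zδ (suc n) ⟨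
          (dilate B zˢ ⊛ δ) (suc n) + (γ ⊛ P.0#) (suc n) ≈⟨ K.+-cong (dilate-z-⊛ B δ n) (P.zeroʳ γ (suc n)) ⟩
          B * δ n + 0#                                   ≈⟨ K.+-identityʳ (B * δ n) ⟩
          B * δ n                                        ∎
          where open CommutativeSemigroupProperties P.*-commutativeSemigroup using (x∙yz≈y∙xz)

      -- The geometric series with ratio xᵃ, cleared of its denominator: a z Γᵃ = β_a (xᵃᵇ - 1).
      zΓᵃ+α : dilate A zˢ ⊛ Γᵃ P.+ α ⊛ 1ˢ P.≈ α ⊛ T (a ℕ.* b)
      zΓᵃ+α = ∑ˢ.clear-denominator (T a) (powers-bernoulli a ƛᵃ#1 K.refl)
        (P.trans (P.+-congˡ {T a ⊛ Γᵃ} (P.sym (powers-0 ƛ))) (∑ˢ.geometric T (powers-+ ƛ) a b))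

    -- Read at zⁿ⁺²: the factors z² of G and z of β_1 are already absorbed into the indices n and n
    -- + 1. It is `zΓᵃ+α` multiplied by β_b, with `γΓᵃ` substituted.
    generating-identity : ∀ n →
      A * (B * (G n + δ (suc n))) + (α ⊛ γ) (suc (suc n)) ≈ ((α ⊛ γ) ⊛ T (a ℕ.* b)) (suc (suc n))
    generating-identity n = begin
      A * (B * (G n + δ (suc n))) + (α ⊛ γ) (suc (suc n))
        ≈⟨ K.+-congʳ (K.*-congˡ (γΓᵃ n)) ⟨
      A * (γ ⊛ Γᵃ) (suc n) + (α ⊛ γ) (suc (suc n))
        ≈⟨ K.+-congʳ (dilate-z-⊛ A (γ ⊛ Γᵃ) (suc n)) ⟨
      (dilate A zˢ ⊛ (γ ⊛ Γᵃ)) (suc (suc n)) + (α ⊛ γ) (suc (suc n))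
        ≈⟨ K.+-cong (x∙yz≈y∙xz (dilate A zˢ) γ Γᵃ (suc (suc n)))
             (P.trans (⊛-comm α γ) (⊛-cong {γ} (λ _ → K.refl) (P.sym (P.*-identityʳ α))) (suc (suc n))) ⟩
      (γ ⊛ (dilate A zˢ ⊛ Γᵃ)) (suc (suc n)) + (γ ⊛ (α ⊛ 1ˢ)) (suc (suc n))
        ≈⟨ P.distribˡ γ (dilate A zˢ ⊛ Γᵃ) (α ⊛ 1ˢ) (suc (suc n)) ⟨
      (γ ⊛ (dilate A zˢ ⊛ Γᵃ P.+ α ⊛ 1ˢ)) (suc (suc n))
        ≈⟨ ⊛-cong {γ} (λ _ → K.refl) zΓᵃ+α (suc (suc n)) ⟩
      (γ ⊛ (α ⊛ T (a ℕ.* b))) (suc (suc n))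
        ≈⟨ P.trans (P.sym (⊛-assoc γ α (T (a ℕ.* b))))
             (⊛-cong {g = T (a ℕ.* b)} (⊛-comm γ α) (λ _ → K.refl)) (suc (suc n)) ⟩
      ((α ⊛ γ) ⊛ T (a ℕ.* b)) (suc (suc n)) ∎
      where open CommutativeSemigroupProperties P.*-commutativeSemigroup using (x∙yz≈y∙xz)

  -- From coefficients to the terms of the formula

  ^ᶻ-pred : ∀ x n → x ^ᶻ (+ n ℤ.- 1ℤ) ≈ x ⁻¹ * proj₁ x ^ n
  -- At exponent -1 both sides are `x ⁻¹ * 1#`, so this case follows the general rule.
  ^ᶻ-pred x zero    = K.refl
  ^ᶻ-pred x (suc n) = begin
    proj₁ x ^ n                      ≈⟨ K.*-identityˡ (proj₁ x ^ n) ⟨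
    1# * proj₁ x ^ n                 ≈⟨ K.*-congʳ (K.trans (K.*-comm (x ⁻¹) (proj₁ x)) (*-inverseʳ x)) ⟨
    x ⁻¹ * proj₁ x * proj₁ x ^ n     ≈⟨ K.*-assoc (x ⁻¹) (proj₁ x) (proj₁ x ^ n) ⟩
    x ⁻¹ * (proj₁ x * proj₁ x ^ n)   ∎

  factorial-suc : ∀ n → ⟨ suc n ⟩ ⁻¹ ≈ suc n !ˣ ⁻¹ * fromℕ (n !)
  factorial-suc n = ⁻¹-unique ⟨ suc n ⟩ (begin
    fromℕ (suc n) * (suc n !ˣ ⁻¹ * fromℕ (n !))  ≈⟨ solve 3 (λ x y z → x :* (y :* z) := x :* z :* y) K.refl _ _ _ ⟩
    fromℕ (suc n) * fromℕ (n !) * suc n !ˣ ⁻¹    ≈⟨ K.*-congʳ (fromℕ-* (suc n) (n !)) ⟨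
    fromℕ (suc n !) * suc n !ˣ ⁻¹                ≈⟨ *-inverseʳ (suc n !ˣ) ⟩
    1#                                           ∎)

  -- The origin of the denominators (ℓ + 1)(ℓ + 2) and (m + 1)(m + 2): a coefficient of β_a β_b at
  -- zⁿ⁺² brings (n + 2)!, whereas n! is wanted.
  factorial-+2 : ∀ n → (⟨ suc n ⟩ ·ˣ ⟨ suc (suc n) ⟩) ⁻¹ * fromℕ ((n ℕ.+ 2) !) ≈ fromℕ (n !)
  factorial-+2 n = begin
    d ⁻¹ * fromℕ ((n ℕ.+ 2) !)                   ≡⟨ cong (λ k → d ⁻¹ * fromℕ (k !)) (ℕ.+-comm n 2) ⟩
    d ⁻¹ * fromℕ (suc (suc n) !)
      ≈⟨ K.*-congˡ (K.trans (fromℕ-* (suc (suc n)) (suc n !)) (K.*-congˡ (fromℕ-* (suc n) (n !)))) ⟩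
    d ⁻¹ * (fromℕ (suc (suc n)) * (fromℕ (suc n) * fromℕ (n !)))
      ≈⟨ solve 4 (λ x y z w → x :* (z :* (y :* w)) := y :* z :* x :* w) K.refl
           (d ⁻¹) (fromℕ (suc n)) (fromℕ (suc (suc n))) (fromℕ (n !)) ⟩
    proj₁ d * d ⁻¹ * fromℕ (n !)                 ≈⟨ K.*-congʳ (*-inverseʳ d) ⟩
    1# * fromℕ (n !)                             ≈⟨ K.*-identityˡ (fromℕ (n !)) ⟩
    fromℕ (n !)                                  ∎
    where d = ⟨ suc n ⟩ ·ˣ ⟨ suc (suc n) ⟩

  ⊛-tail₂ : ∀ f g n → f 0 ≈ 0# → f 1 ≈ 0# →
    (f ⊛ g) (suc (suc n)) ≈ ∑[ k ≤ n ] (f (suc (suc k)) * g (n ∸ k))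
  ⊛-tail₂ f g n f₀≈0 f₁≈0 = K.trans (drop f₀≈0) (drop f₁≈0)
    where
    drop : ∀ {x y z} → x ≈ 0# → x * y + z ≈ z
    drop {y = y} {z} x≈0 = K.trans (K.+-congʳ (K.trans (K.*-congʳ x≈0) (K.zeroˡ y))) (K.+-identityˡ z)

  ∑ˡ-coefficient : ∀ ns (f : ℕ → PowerSeries) k → ∑ˡ ns f k ≡ ∑[ n ∈ ns ] f n k
  ∑ˡ-coefficient []       f k = refl
  ∑ˡ-coefficient (n ∷ ns) f k = cong (λ s → f n k + s) (∑ˡ-coefficient ns f k)

  -- The coefficient of zᵐ in (ƛ eᶻ)ⁿ is ƛⁿ nᵐ / m!.
  S≈ : ∀ m ƛ a b .{{_ : NonZero a}} .{{_ : NonZero b}} →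
    S m ƛ a b ≈ ƛ ⁻¹ * fromℕ (m !) * ∑ˡ (Defs.NR a b) (powers (proj₁ ƛ)) m
  S≈ m ƛ a b = begin
    ∑[ n ∈ NR ] (ƛ ^ᶻ (+ n ℤ.- 1ℤ) * fromℕ n ^ m)
      ≈⟨ ∑ᴷ.∑ˡ-cong NR summand ⟩
    ∑[ n ∈ NR ] (ƛ ⁻¹ * fromℕ (m !) * powers (proj₁ ƛ) n m)
      ≈⟨ ∑ᴷ.*-distribˡ-∑ˡ (ƛ ⁻¹ * fromℕ (m !)) NR (λ n → powers (proj₁ ƛ) n m) ⟨
    ƛ ⁻¹ * fromℕ (m !) * ∑[ n ∈ NR ] powers (proj₁ ƛ) n m
      ≡⟨ cong (λ s → ƛ ⁻¹ * fromℕ (m !) * s) (∑ˡ-coefficient NR (powers (proj₁ ƛ)) m) ⟨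
    ƛ ⁻¹ * fromℕ (m !) * ∑ˡ NR (powers (proj₁ ƛ)) m ∎
    where
    module ∑ᴷ = ListSums field-commutativeRing
    NR = Defs.NR a b

    summand : ∀ n → ƛ ^ᶻ (+ n ℤ.- 1ℤ) * fromℕ n ^ m ≈ ƛ ⁻¹ * fromℕ (m !) * powers (proj₁ ƛ) n m
    summand n = begin
      ƛ ^ᶻ (+ n ℤ.- 1ℤ) * N               ≈⟨ K.*-congʳ (^ᶻ-pred ƛ n) ⟩
      ƛ ⁻¹ * ƛⁿ * N                       ≈⟨ K.*-identityʳ _ ⟨
      ƛ ⁻¹ * ƛⁿ * N * 1#                  ≈⟨ K.*-congˡ (*-inverseʳ (m !ˣ)) ⟨
      ƛ ⁻¹ * ƛⁿ * N * (fromℕ (m !) * m !ˣ ⁻¹)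
        ≈⟨ solve 5 (λ l p n x y → l :* p :* n :* (x :* y) := l :* x :* (p :* (n :* y)))
             K.refl (ƛ ⁻¹) ƛⁿ N (fromℕ (m !)) (m !ˣ ⁻¹) ⟩
      ƛ ⁻¹ * fromℕ (m !) * powers (proj₁ ƛ) n m ∎
      where
      N  = fromℕ n ^ m
      ƛⁿ = proj₁ ƛ ^ n

  -- Comparison of coefficients

  module _ (a b : ℕ) .{{_ : NonZero a}} .{{_ : NonZero b}} (coprime : gcd a b ≡ 1)
    (ƛ : Nonzero) (ƛᵃ#1 : proj₁ ƛ ^ a # 1#) (ƛᵇ#1 : proj₁ ƛ ^ b # 1#) where

    private

      A   = fromℕ a
      B   = fromℕ b
      A⁻¹ = ⟨ a ⟩ ⁻¹
      B⁻¹ = ⟨ b ⟩ ⁻¹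
      α   = dilate A (bernoulli (proj₁ ƛ ^ a) ƛᵃ#1)
      γ   = dilate B (bernoulli (proj₁ ƛ ^ b) ƛᵇ#1)
      𝓑ᵃ 𝓑ᵇ : ℕ → Carrier
      𝓑ᵃ i = 𝓑 i (proj₁ ƛ ^ a) ƛᵃ#1
      𝓑ᵇ i = 𝓑 i (proj₁ ƛ ^ b) ƛᵇ#1

      αγ₀≈0 : (α ⊛ γ) 0 ≈ 0#
      αγ₀≈0 = ⊛-zeroˡ {α} γ 0 λ { .0 ℕ.z≤n → K.trans (K.*-congˡ (bernoulli-0 _ ƛᵃ#1)) (K.zeroʳ 1#) }

      αγ₁≈0 : (α ⊛ γ) 1 ≈ 0#
      αγ₁≈0 = begin
        α 0 * γ 1 + (α 1 * γ 0 + 0#)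
          ≈⟨ K.+-cong (K.*-congʳ (K.*-congˡ (bernoulli-0 _ ƛᵃ#1)))
               (K.+-congʳ (K.*-congˡ (K.*-congˡ (bernoulli-0 _ ƛᵇ#1)))) ⟩
        1# * 0# * γ 1 + (α 1 * (1# * 0#) + 0#)
          ≈⟨ solve 2 (λ x y → con 1 :* con 0 :* x :+ (y :* (con 1 :* con 0) :+ con 0) := con 0) K.refl (γ 1) (α 1) ⟩
        0# ∎

      -- The common shape of the summands in both sums: p = 0 and n = m + 2 in the single sum, p = m
      -- - ℓ and n = ℓ + 2 in the double one.
      product-term : ℕ → ℕ → ℕ → Carrier
      product-term p n i = fromℕ (n C i)
        * (⟨ a ⟩ ^ᶻ (+ (p ℕ.+ i) ℤ.- 1ℤ) * ⟨ b ⟩ ^ᶻ (+ (p ℕ.+ (n ∸ i)) ℤ.- 1ℤ)) * 𝓑ᵃ i * 𝓑ᵇ (n ∸ i)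

      first-term : ℕ → ℕ → ℕ → Carrier
      first-term m ℓ i = fromℕ ((ℓ ℕ.+ 2) C i) * fromℕ (m C ℓ)
        * ((⟨ a ⟩ ^ᶻ (+ m ℤ.- + ℓ ℤ.+ + i ℤ.- 1ℤ) * ⟨ b ⟩ ^ᶻ (+ m ℤ.- + i ℤ.+ 1ℤ))
            / (⟨ suc ℓ ⟩ ·ˣ ⟨ suc (suc ℓ) ⟩))
        * 𝓑ᵃ i * 𝓑ᵇ (ℓ ℕ.+ 2 ∸ i)

      second-term : ℕ → ℕ → Carrier
      second-term m i = fromℕ ((m ℕ.+ 2) C i)
        * ⟨ a ⟩ ^ᶻ (+ i ℤ.- 1ℤ) * ⟨ b ⟩ ^ᶻ (+ m ℤ.- + i ℤ.+ 1ℤ) * 𝓑ᵃ i * 𝓑ᵇ (m ℕ.+ 2 ∸ i)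

      -- The factorials of the binomial coefficient turn 𝓑 into coefficients of β_a and β_b, leaving
      -- n! and (a b)ᵖ⁻¹ as common factors.
      ∑-product-term : ∀ p n → ∑≤ n (product-term p n) ≈ fromℕ (n !) * (A⁻¹ * B⁻¹) * (A ^ p * B ^ p) * (α ⊛ γ) n
      ∑-product-term p n = K.trans (∑≤-cong n summand) (K.sym (*-distribˡ-∑≤ n _ (λ i → α i * γ (n ∸ i))))
        where
        summand : ∀ i → i ℕ.≤ n →
          product-term p n i ≈ fromℕ (n !) * (A⁻¹ * B⁻¹) * (A ^ p * B ^ p) * (α i * γ (n ∸ i))
        summand i i≤n = begin
          product-term p n i
            ≈⟨ K.*-congʳ (K.*-congʳ (K.*-cong (fromℕ-C i≤n) (K.*-cong
                 (K.trans (^ᶻ-pred ⟨ a ⟩ (p ℕ.+ i)) (K.*-congˡ (^-homo-* A p i)))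
                 (K.trans (^ᶻ-pred ⟨ b ⟩ (p ℕ.+ j)) (K.*-congˡ (^-homo-* B p j)))))) ⟩
          fromℕ (n !) * (i !ˣ ⁻¹ * j !ˣ ⁻¹) * (A⁻¹ * (A ^ p * A ^ i) * (B⁻¹ * (B ^ p * B ^ j))) * 𝓑ᵃ i * 𝓑ᵇ j
            ≈⟨ solve 11 (λ n! i! j! a⁻¹ aᵖ aⁱ b⁻¹ bᵖ bʲ x y →
                 n! :* (i! :* j!) :* (a⁻¹ :* (aᵖ :* aⁱ) :* (b⁻¹ :* (bᵖ :* bʲ))) :* x :* y
                   := n! :* (a⁻¹ :* b⁻¹) :* (aᵖ :* bᵖ) :* (aⁱ :* (x :* i!) :* (bʲ :* (y :* j!)))) K.refl
                 (fromℕ (n !)) (i !ˣ ⁻¹) (j !ˣ ⁻¹) A⁻¹ (A ^ p) (A ^ i) B⁻¹ (B ^ p) (B ^ j) (𝓑ᵃ i) (𝓑ᵇ j) ⟩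
          fromℕ (n !) * (A⁻¹ * B⁻¹) * (A ^ p * B ^ p) * (α i * γ j) ∎
          where j = n ∸ i

      second-sum : ∀ m → 1# / (⟨ suc m ⟩ ·ˣ ⟨ suc (suc m) ⟩ ·ˣ ƛ) * ∑≤ (m ℕ.+ 2) (second-term m)
        ≈ ƛ ⁻¹ * fromℕ (m !) * (A⁻¹ * B⁻¹ * (α ⊛ γ) (suc (suc m)))
      second-sum m = begin
        1# * (d ·ˣ ƛ) ⁻¹ * ∑≤ n (second-term m)
          ≈⟨ K.*-cong (K.trans (K.*-identityˡ _) (·ˣ-⁻¹ d ƛ))
               (K.trans (∑≤-cong n summand) (∑-product-term 0 n)) ⟩
        d ⁻¹ * ƛ ⁻¹ * (fromℕ (n !) * (A⁻¹ * B⁻¹) * (1# * 1#) * (α ⊛ γ) n)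
          ≈⟨ solve 5 (λ d l n! e h → d :* l :* (n! :* e :* (con 1 :* con 1) :* h) := l :* (d :* n!) :* (e :* h))
               K.refl (d ⁻¹) (ƛ ⁻¹) (fromℕ (n !)) (A⁻¹ * B⁻¹) _ ⟩
        ƛ ⁻¹ * (d ⁻¹ * fromℕ (n !)) * (A⁻¹ * B⁻¹ * (α ⊛ γ) n)
          ≈⟨ K.*-cong (K.*-congˡ (factorial-+2 m)) (K.*-congˡ (K.reflexive (cong (α ⊛ γ) (ℕ.+-comm m 2)))) ⟩
        ƛ ⁻¹ * fromℕ (m !) * (A⁻¹ * B⁻¹ * (α ⊛ γ) (suc (suc m))) ∎
        where
        n = m ℕ.+ 2
        d = ⟨ suc m ⟩ ·ˣ ⟨ suc (suc m) ⟩

        summand : ∀ i → i ℕ.≤ n → second-term m i ≈ product-term 0 n i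
        summand i i≤n = K.*-congʳ (K.*-congʳ (K.trans
          (K.*-assoc (fromℕ (n C i)) (⟨ a ⟩ ^ᶻ (+ i ℤ.- 1ℤ)) (⟨ b ⟩ ^ᶻ (+ m ℤ.- + i ℤ.+ 1ℤ)))
          (K.*-congˡ (K.*-congˡ (K.reflexive (cong (⟨ b ⟩ ^ᶻ_) (exponent-b m i (n ∸ i) (ℕ.m∸n+n≡m i≤n))))))))

      -- In xᵃᵇ β_a β_b, the coefficient of xᵃᵇ at degree m - ℓ is ƛᵃᵇ (a b)ᵐ⁻ˡ / (m - ℓ)!, writing
      -- l for ℓ in the exponent, and it meets β_a β_b at degree ℓ + 2. Multiplication by m!
      -- together with `factorial-+2` then produces `m C ℓ`.
      first-sum : ∀ m → ƛ ^ᶻ (+ (a ℕ.* b) ℤ.- 1ℤ) * ∑[ ℓ ≤ m ] ∑≤ (ℓ ℕ.+ 2) (first-term m ℓ)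
        ≈ ƛ ⁻¹ * fromℕ (m !) * (A⁻¹ * B⁻¹ * ((α ⊛ γ) ⊛ powers (proj₁ ƛ) (a ℕ.* b)) (suc (suc m)))
      first-sum m = begin
        ƛ ^ᶻ (+ (a ℕ.* b) ℤ.- 1ℤ) * ∑[ ℓ ≤ m ] ∑≤ (ℓ ℕ.+ 2) (first-term m ℓ)
          ≈⟨ K.*-cong (^ᶻ-pred ƛ (a ℕ.* b)) (K.trans
               (∑≤-cong m {λ ℓ → ∑≤ (ℓ ℕ.+ 2) (first-term m ℓ)} inner)
               (K.sym (*-distribˡ-∑≤ m e (λ ℓ → H ℓ * scaled (m ∸ ℓ))))) ⟩
        ƛ ⁻¹ * ƛᵃᵇ * (e * ∑[ ℓ ≤ m ] (H ℓ * scaled (m ∸ ℓ)))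
          ≈⟨ solve 5 (λ l p m! e s → l :* p :* (m! :* e :* s) := l :* m! :* (e :* (p :* s)))
               K.refl (ƛ ⁻¹) ƛᵃᵇ (fromℕ (m !)) (A⁻¹ * B⁻¹) _ ⟩
        ƛ ⁻¹ * fromℕ (m !) * (A⁻¹ * B⁻¹ * (ƛᵃᵇ * ∑[ ℓ ≤ m ] (H ℓ * scaled (m ∸ ℓ))))
          ≈⟨ K.*-congˡ (K.*-congˡ tail) ⟨
        ƛ ⁻¹ * fromℕ (m !) * (A⁻¹ * B⁻¹ * ((α ⊛ γ) ⊛ powers (proj₁ ƛ) (a ℕ.* b)) (suc (suc m))) ∎
        where
        ƛᵃᵇ = proj₁ ƛ ^ (a ℕ.* b)
        e   = fromℕ (m !) * (A⁻¹ * B⁻¹)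

        H scaled : ℕ → Carrier
        H ℓ      = (α ⊛ γ) (suc (suc ℓ))
        scaled p = A ^ p * B ^ p / p !ˣ

        powers≈ : ∀ p → powers (proj₁ ƛ) (a ℕ.* b) p ≈ ƛᵃᵇ * scaled p
        powers≈ p = K.*-congˡ (K.*-congʳ (K.trans (^-congˡ p (fromℕ-* a b)) (^-distrib-* A B p)))

        tail : ((α ⊛ γ) ⊛ powers (proj₁ ƛ) (a ℕ.* b)) (suc (suc m)) ≈ ƛᵃᵇ * ∑[ ℓ ≤ m ] (H ℓ * scaled (m ∸ ℓ))
        tail = K.trans (⊛-tail₂ (α ⊛ γ) (powers (proj₁ ƛ) (a ℕ.* b)) m αγ₀≈0 αγ₁≈0)
          (K.trans (∑≤-cong m λ ℓ _ → K.trans (K.*-congˡ (powers≈ (m ∸ ℓ)))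
            (solve 3 (λ x y z → x :* (y :* z) := y :* (x :* z)) K.refl (H ℓ) ƛᵃᵇ (scaled (m ∸ ℓ))))
          (K.sym (*-distribˡ-∑≤ m ƛᵃᵇ (λ ℓ → H ℓ * scaled (m ∸ ℓ)))))

        inner : ∀ ℓ → ℓ ℕ.≤ m → ∑≤ (ℓ ℕ.+ 2) (first-term m ℓ) ≈ e * (H ℓ * scaled (m ∸ ℓ))
        inner ℓ ℓ≤m = begin
          ∑≤ n (first-term m ℓ)
            ≈⟨ ∑≤-cong n {first-term m ℓ} summand ⟩
          ∑[ i ≤ n ] (fromℕ (m C ℓ) * d ⁻¹ * product-term p n i)
            ≈⟨ *-distribˡ-∑≤ n (fromℕ (m C ℓ) * d ⁻¹) (product-term p n) ⟨
          fromℕ (m C ℓ) * d ⁻¹ * ∑≤ n (product-term p n)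
            ≈⟨ K.*-cong (K.*-congʳ (fromℕ-C ℓ≤m)) (∑-product-term p n) ⟩
          fromℕ (m !) * (ℓ !ˣ ⁻¹ * p !ˣ ⁻¹) * d ⁻¹ * (fromℕ (n !) * (A⁻¹ * B⁻¹) * (A ^ p * B ^ p) * (α ⊛ γ) n)
            ≈⟨ solve 8 (λ m! ℓ! p! d n! e s h → m! :* (ℓ! :* p!) :* d :* (n! :* e :* s :* h)
                 := d :* n! :* ℓ! :* (m! :* e :* (h :* (s :* p!))))
                 K.refl (fromℕ (m !)) (ℓ !ˣ ⁻¹) (p !ˣ ⁻¹) (d ⁻¹) (fromℕ (n !)) (A⁻¹ * B⁻¹) (A ^ p * B ^ p) _ ⟩
          d ⁻¹ * fromℕ (n !) * ℓ !ˣ ⁻¹ * (e * ((α ⊛ γ) n * scaled p))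
            ≈⟨ K.*-congʳ (K.trans (K.*-congʳ (factorial-+2 ℓ)) (*-inverseʳ (ℓ !ˣ))) ⟩
          1# * (e * ((α ⊛ γ) n * scaled p))
            ≈⟨ K.*-identityˡ _ ⟩
          e * ((α ⊛ γ) n * scaled p)
            ≡⟨ cong (λ k → e * ((α ⊛ γ) k * scaled p)) (ℕ.+-comm ℓ 2) ⟩
          e * (H ℓ * scaled p) ∎
          where
          n = ℓ ℕ.+ 2
          p = m ∸ ℓ
          d = ⟨ suc ℓ ⟩ ·ˣ ⟨ suc (suc ℓ) ⟩

          p+[n∸i]+i≡m+2 : ∀ {i} → i ℕ.≤ n → p ℕ.+ (n ∸ i) ℕ.+ i ≡ m ℕ.+ 2
          p+[n∸i]+i≡m+2 {i} i≤n = trans (ℕ.+-assoc p (n ∸ i) i) (trans (cong (p ℕ.+_) (ℕ.m∸n+n≡m i≤n))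
            (trans (sym (ℕ.+-assoc p ℓ 2)) (cong (ℕ._+ 2) (ℕ.m∸n+n≡m ℓ≤m))))

          summand : ∀ i → i ℕ.≤ n → first-term m ℓ i ≈ fromℕ (m C ℓ) * d ⁻¹ * product-term p n i
          summand i i≤n = K.trans
            (K.*-congʳ (K.*-congʳ (K.*-congˡ (K.*-congʳ (K.*-cong
              (K.reflexive (cong (⟨ a ⟩ ^ᶻ_) (exponent-a i ℓ≤m)))
              (K.reflexive (cong (⟨ b ⟩ ^ᶻ_) (exponent-b m i _ (p+[n∸i]+i≡m+2 i≤n)))))))))
            (solve 6 (λ c c′ z d x y → c :* c′ :* (z :* d) :* x :* y := c′ :* d :* (c :* z :* x :* y))
              K.refl (fromℕ (n C i)) (fromℕ (m C ℓ)) _ (d ⁻¹) (𝓑ᵃ i) (𝓑ᵇ (n ∸ i)))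

    S-formula : ∀ (ƛ#1 : proj₁ ƛ # 1#) m → S m ƛ a b ≈
        ƛ ^ᶻ (+ (a ℕ.* b) ℤ.- 1ℤ)
          * (∑[ ℓ ≤ m ] ∑[ i ≤ ℓ ℕ.+ 2 ]
              (fromℕ ((ℓ ℕ.+ 2) C i) * fromℕ (m C ℓ)
                * ((⟨ a ⟩ ^ᶻ (+ m ℤ.- + ℓ ℤ.+ + i ℤ.- 1ℤ) * ⟨ b ⟩ ^ᶻ (+ m ℤ.- + i ℤ.+ 1ℤ))
                    / (⟨ suc ℓ ⟩ ·ˣ ⟨ suc (suc ℓ) ⟩))
                * 𝓑 i (proj₁ ƛ ^ a) ƛᵃ#1 * 𝓑 (ℓ ℕ.+ 2 ∸ i) (proj₁ ƛ ^ b) ƛᵇ#1))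
      - 1# / (⟨ suc m ⟩ ·ˣ ⟨ suc (suc m) ⟩ ·ˣ ƛ)
          * (∑[ i ≤ m ℕ.+ 2 ]
              (fromℕ ((m ℕ.+ 2) C i)
                * ⟨ a ⟩ ^ᶻ (+ i ℤ.- 1ℤ) * ⟨ b ⟩ ^ᶻ (+ m ℤ.- + i ℤ.+ 1ℤ)
                * 𝓑 i (proj₁ ƛ ^ a) ƛᵃ#1 * 𝓑 (m ℕ.+ 2 ∸ i) (proj₁ ƛ ^ b) ƛᵇ#1))
      - 𝓑 (suc m) (proj₁ ƛ) ƛ#1 / (⟨ suc m ⟩ ·ˣ ƛ)
    S-formula ƛ#1 m = begin
      S m ƛ a b                                    ≈⟨ S≈ m ƛ a b ⟩
      w * G                                        ≈⟨ x+y-y≈x (w * G) (w * δ) ⟨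
      -- The other two terms of the formula are added and subtracted; by `total`, what precedes the
      -- subtractions is the double sum.
      w * G + w * δ - w * δ                        ≈⟨ K.+-congʳ (x+y-y≈x _ (w * (A⁻¹B⁻¹ * h))) ⟨
      w * G + w * δ + w * (A⁻¹B⁻¹ * h) - w * (A⁻¹B⁻¹ * h) - w * δ
        ≈⟨ K.+-cong (K.+-cong total (K.-‿cong (second-sum m))) (K.-‿cong third) ⟨
      _ ∎
      where
      A⁻¹B⁻¹ = A⁻¹ * B⁻¹
      w = ƛ ⁻¹ * fromℕ (m !)
      G = ∑ˡ (Defs.NR a b) (powers (proj₁ ƛ)) m
      h = (α ⊛ γ) (suc (suc m))
      δ = dilate (fromℕ 1) (bernoulli (proj₁ ƛ) ƛ#1) (suc m)

      x+y-y≈x : ∀ x y → x + y - y ≈ x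
      x+y-y≈x x y = K.trans (K.+-assoc x y (- y)) (K.trans (K.+-congˡ (K.-‿inverseʳ y)) (K.+-identityʳ x))

      total : ƛ ^ᶻ (+ (a ℕ.* b) ℤ.- 1ℤ) * ∑[ ℓ ≤ m ] ∑≤ (ℓ ℕ.+ 2) (first-term m ℓ) ≈ w * G + w * δ + w * (A⁻¹B⁻¹ * h)
      total = begin
        ƛ ^ᶻ (+ (a ℕ.* b) ℤ.- 1ℤ) * ∑[ ℓ ≤ m ] ∑≤ (ℓ ℕ.+ 2) (first-term m ℓ)
          ≈⟨ first-sum m ⟩
        w * (A⁻¹B⁻¹ * ((α ⊛ γ) ⊛ powers (proj₁ ƛ) (a ℕ.* b)) (suc (suc m)))
          -- The coefficient identity, scaled by m! / (a b ƛ); the factor a b in front of G + β_1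
          -- then cancels.
          ≈⟨ K.*-congˡ (K.*-congˡ (generating-identity a b coprime ƛ#1 ƛᵃ#1 ƛᵇ#1 m)) ⟨
        w * (A⁻¹B⁻¹ * (A * (B * (G + δ)) + h))
          ≈⟨ solve 8 (λ w a⁻¹ b⁻¹ a b g d h → w :* (a⁻¹ :* b⁻¹ :* (a :* (b :* (g :+ d)) :+ h))
               := a :* a⁻¹ :* (b :* b⁻¹) :* (w :* g :+ w :* d) :+ w :* (a⁻¹ :* b⁻¹ :* h)) K.refl w A⁻¹ B⁻¹ A B G δ h ⟩
        A * A⁻¹ * (B * B⁻¹) * (w * G + w * δ) + w * (A⁻¹B⁻¹ * h)
          ≈⟨ K.+-congʳ (K.trans (K.*-congʳ (K.trans (K.*-cong (*-inverseʳ ⟨ a ⟩) (*-inverseʳ ⟨ b ⟩)) (K.*-identityˡ 1#)))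
               (K.*-identityˡ _)) ⟩
        w * G + w * δ + w * (A⁻¹B⁻¹ * h) ∎

      1^n≈1 : ∀ n → fromℕ 1 ^ n ≈ 1#
      1^n≈1 zero    = K.refl
      1^n≈1 (suc n) = K.trans (K.*-cong fromℕ-1 (1^n≈1 n)) (K.*-identityˡ 1#)

      third : 𝓑 (suc m) (proj₁ ƛ) ƛ#1 / (⟨ suc m ⟩ ·ˣ ƛ) ≈ w * δ
      third = begin
        𝓑ₘ₊₁ * (⟨ suc m ⟩ ·ˣ ƛ) ⁻¹
          ≈⟨ K.*-congˡ (K.trans (·ˣ-⁻¹ ⟨ suc m ⟩ ƛ) (K.*-congʳ (factorial-suc m))) ⟩
        𝓑ₘ₊₁ * (suc m !ˣ ⁻¹ * fromℕ (m !) * ƛ ⁻¹)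
          ≈⟨ solve 4 (λ x y z l → x :* (y :* z :* l) := l :* z :* (con 1 :* (x :* y))) K.refl
               𝓑ₘ₊₁ (suc m !ˣ ⁻¹) (fromℕ (m !)) (ƛ ⁻¹) ⟩
        w * (1# * (𝓑ₘ₊₁ * suc m !ˣ ⁻¹))
          ≈⟨ K.*-congˡ (K.*-congʳ (1^n≈1 (suc m))) ⟨
        w * δ ∎
        where 𝓑ₘ₊₁ = 𝓑 (suc m) (proj₁ ƛ) ƛ#1

open import Defs

theorem2 : ∀ (a b : ℕ) .{{_ : NonZero a}} .{{_ : NonZero b}} → gcd a b ≡ 1 →
  ∀ (ƛ : ℂ) (ƛ#0 : ƛ # 0#) (ƛᵃ#1 : ƛ ^ a # 1#) (ƛᵇ#1 : ƛ ^ b # 1#) (m : ℕ) →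
  S m (ƛ , ƛ#0) a b ≈
      (ƛ , ƛ#0) ^ᶻ (+ (a ℕ.* b) ℤ.- 1ℤ)
        * (∑[ ℓ ≤ m ] ∑[ i ≤ ℓ ℕ.+ 2 ]
            (fromℕ ((ℓ ℕ.+ 2) C i) * fromℕ (m C ℓ)
              * ((⟨ a ⟩ ^ᶻ (+ m ℤ.- + ℓ ℤ.+ + i ℤ.- 1ℤ) * ⟨ b ⟩ ^ᶻ (+ m ℤ.- + i ℤ.+ 1ℤ))
                  / (⟨ suc ℓ ⟩ ·ˣ ⟨ suc (suc ℓ) ⟩))
              * 𝓑 i (ƛ ^ a) ƛᵃ#1 * 𝓑 (ℓ ℕ.+ 2 ∸ i) (ƛ ^ b) ƛᵇ#1))
    - 1# / (⟨ suc m ⟩ ·ˣ ⟨ suc (suc m) ⟩ ·ˣ (ƛ , ƛ#0))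
        * (∑[ i ≤ m ℕ.+ 2 ]
            (fromℕ ((m ℕ.+ 2) C i)
              * ⟨ a ⟩ ^ᶻ (+ i ℤ.- 1ℤ) * ⟨ b ⟩ ^ᶻ (+ m ℤ.- + i ℤ.+ 1ℤ)
              * 𝓑 i (ƛ ^ a) ƛᵃ#1 * 𝓑 (m ℕ.+ 2 ∸ i) (ƛ ^ b) ƛᵇ#1))
    - 𝓑 (suc m) ƛ (^#1⇒#1 a ƛᵃ#1) / (⟨ suc m ⟩ ·ˣ (ƛ , ƛ#0))
-- The last term evaluates 𝓑 at ƛ itself, which calls for ƛ apart from 1; this is deduced from ƛᵃ
-- being apart from 1.
theorem2 a b coprime ƛ ƛ#0 ƛᵃ#1 ƛᵇ#1 m =
  Series.S-formula ℂ-field ℂ-char0 a b coprime (ƛ , ƛ#0) ƛᵃ#1 ƛᵇ#1 (^#1⇒#1 a ƛᵃ#1) m
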